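{- Let $n$ and $k$ be positive integers with $n\ge k+1$, and let $n=q(k+1)+r$ where $q$ and $r$ are the unique integers such that $0\le r\le k$. Then the minimum size of a (finite simple) chordal graph of order $n$ and minimum degree $k$ is $$ q\binom{k+1}{2}+kr-\frac{r(r-1)}{2}. $$
   Context: All graphs are finite and simple. The order of a graph is its number of vertices and its size is its number of edges. A chord of a cycle $C$ in a graph is an edge of the graph not in $E(C)$ both of whose endpoints lie on $C$. A graph is chordal if every cycle of length greater than three has a chord (equivalently, it contains no induced cycle of length greater than three). Chordal graphs are not required to be connected. "Minimum degree $k$" means that the minimum degree is exactly $k$. "The minimum size is $m$" means that every such graph has at least $m$ edges and some such graph has exactly $m$ edges. -}

module Defs where

open import Data.Fin.Base as Fin using (Fin; toℕ)
import Data.Fin.Properties as Fin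
open import Data.List.Base using (List; length; filter; allFin; cartesianProduct)
open import Data.Nat.Base using (ℕ; suc; _≤_; _<_)
open import Data.Product.Base using (Σ-syntax; ∃-syntax; _×_; _,_)
open import Data.Sum.Base using (_⊎_)
open import Function.Definitions using (Injective)
open import Level using (0ℓ)
open import Relation.Binary.Core using (Rel)
open import Relation.Binary.Definitions using (Decidable; Irreflexive; Symmetric)
open import Relation.Binary.PropositionalEquality.Core using (_≡_)
open import Relation.Nullary.Decidable.Core using (_×-dec_)
open import Relation.Nullary.Negation.Core using (¬_)

-- Simple graphs of order n, on the vertex set Fin n.
record Graph (n : ℕ) : Set₁ where
  infix 4 _~_ _~?_
  field
    _~_    : Rel (Fin n) 0ℓ
    _~?_   : Decidable _~_
    sym    : Symmetric _~_
    irrefl : Irreflexive _≡_ _~_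

  degree : Fin n → ℕ
  degree v = length (filter (v ~?_) (allFin n))

  -- Each edge {u , v} is listed once, as the pair with u < v.
  edges : List (Fin n × Fin n)
  edges = filter (λ (u , v) → (u Fin.<? v) ×-dec (u ~? v))
                 (cartesianProduct (allFin n) (allFin n))

  size : ℕ
  size = length edges

-- j is the successor of i in the cyclic order 0, 1, …, m - 1, 0.
Next : ∀ {m} → Fin m → Fin m → Set
Next {m} i j = toℕ j ≡ suc (toℕ i) ⊎ (suc (toℕ i) ≡ m × toℕ j ≡ 0)

record Cycle {n : ℕ} (G : Graph n) (m : ℕ) : Set where
  open Graph G
  field
    3≤length  : 3 ≤ m
    vertex    : Fin m → Fin n
    injective : Injective _≡_ _≡_ vertex
    adjacent  : ∀ {i j} → Next i j → vertex i ~ vertex j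

  LiesOn : Fin n → Set
  LiesOn v = ∃[ i ] vertex i ≡ v

  IsEdge : Fin n → Fin n → Set
  IsEdge u v = ∃[ i ] ∃[ j ] Next i j ×
    ((vertex i ≡ u × vertex j ≡ v) ⊎ (vertex i ≡ v × vertex j ≡ u))

  IsChord : Fin n → Fin n → Set
  IsChord u v = u ~ v × ¬ IsEdge u v × LiesOn u × LiesOn v

Chordal : ∀ {n} → Graph n → Set
Chordal G = ∀ {m} (C : Cycle G m) → 3 < m → ∃[ u ] ∃[ v ] Cycle.IsChord C u v

HasMinDegree : ∀ {n} → Graph n → ℕ → Set
HasMinDegree G k = (∀ v → k ≤ degree v) × ∃[ v ] degree v ≡ k
  where open Graph G

IsMinimumSize : ∀ {n} → (Graph n → Set) → ℕ → Set₁
IsMinimumSize {n} P m =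
  (∀ (G : Graph n) → P G → m ≤ Graph.size G) ×
  (Σ[ G ∈ Graph n ] P G × Graph.size G ≡ m)

{-# OPTIONS --safe #-}
-- Let N[v] be the closed neighbourhood of v and K = k + 1.  Every chordal graph of order n = qK + r,
-- whatever its degrees, satisfies  ∑ᵥ | |N[v]| - K | ≥ r (K - r).  Indeed, a clique S with |S| ≥ K can
-- be deleted: an edge leaving S adds one to the term of its end in S, which pays for the loss at its
-- other end.  If there is no such clique and the graph is not complete, then there are a clique X, all
-- of whose vertices have the same clique S as closed neighbourhood, and a vertex y ∉ S adjacent to
-- S ∖ X.  Joining y to X keeps the graph chordal and does not increase the sum, as |S| < K.
-- When all degrees are at least k, the sum is 2e - kn, and this gives the lower bound.  Equality holds
-- for q - 1 disjoint cliques of order K together with two cliques of order K sharing K - r vertices.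
module Submission where

import Algebra.Properties.Semiring.Sum as ∑
open import Data.Bool.Base using (Bool; true; false; T; not; _∧_; _∨_; if_then_else_)
open import Data.Bool.Properties using (T-∧; T?)
open import Data.Empty using (⊥; ⊥-elim)
open import Data.Fin.Base as Fin using (Fin; zero; suc; toℕ)
import Data.Fin.Properties as Fin
open import Data.List.Base
  using ([]; _∷_; _++_; length; filter; allFin; tabulate; map; cartesianProduct)
open import Data.List.Properties using (length-++; filter-++)
open import Data.Nat
open import Data.Nat.Combinatorics using (_C_; nC1≡n; nCk+nC[k+1]≡[n+1]C[k+1])
open import Data.Nat.DivMod
  using (m≡m%n+[m/n]*n; m%n<n; m/n*n≤m; m*n/n≡m; /-monoˡ-≤; m<n*o⇒m/o<n)
open import Data.Nat.Induction using (Acc; acc; <-wellFounded)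
open import Data.Nat.Properties
open import Data.Nat.Tactic.RingSolver using (solve-∀)
open import Data.Product.Base as Product using (∃; ∃₂; _×_; _,_; proj₁; proj₂)
open import Data.Sum.Base as Sum using (_⊎_; inj₁; inj₂; [_,_]′)
open import Data.Unit.Base using (tt)
open import Function.Base using (_∘_; const; id)
open import Function.Bundles using (module Equivalence)
open import Relation.Binary.Construct.Closure.ReflexiveTransitive as Star using (Star; ε; _◅_; _◅◅_)
open import Relation.Binary.Definitions using (Tri; tri<; tri≈; tri>)
open import Relation.Binary.PropositionalEquality
open import Relation.Nullary.Decidable
  using (Dec; yes; no; does; map′; _×-dec_; _⊎-dec_; ¬?; decidable-stable; dec-true; dec-false)
open import Relation.Nullary.Negation using (¬_; contradiction)
open import Defs

open ∑ +-*-semiring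
  using (sum; ∑-distrib-+; ∑-comm; *-distribˡ-sum; *-distribʳ-sum; sum-cong-≗; sum-replicate-zero)

private variable
  n : ℕ

-- Sums over vertices.

sum-mono-≤ : {f g : Fin n → ℕ} → (∀ i → f i ≤ g i) → sum f ≤ sum g
sum-mono-≤ {zero}  f≤g = z≤n
sum-mono-≤ {suc n} f≤g = +-mono-≤ (f≤g zero) (sum-mono-≤ (f≤g ∘ suc))

sum-mono-< : {f g : Fin n → ℕ} → (∀ i → f i ≤ g i) → ∀ i → f i < g i → sum f < sum g
sum-mono-< f≤g zero    f<g = +-mono-<-≤ f<g (sum-mono-≤ (f≤g ∘ suc))
sum-mono-< f≤g (suc i) f<g = +-mono-≤-< (f≤g zero) (sum-mono-< (f≤g ∘ suc) i f<g)

sum-const : ∀ n c → sum {n} (λ _ → c) ≡ n * c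
sum-const zero    c = refl
sum-const (suc n) c = cong (c +_) (sum-const n c)

-- Vertex sets and closed neighbourhoods

VertexSet : ℕ → Set
VertexSet n = Fin n → Bool

infix 4 _∈_ _∉_ _∈?_ _⊆_
infixl 7 _∩_ _∖_

-- A record, so that v and S can be inferred from a proof of membership.
record _∈_ (v : Fin n) (S : VertexSet n) : Set where
  constructor mem
  field holds : T (S v)

open _∈_

_∉_ : Fin n → VertexSet n → Set
v ∉ S = ¬ v ∈ S

_∈?_ : (v : Fin n) (S : VertexSet n) → Dec (v ∈ S)
v ∈? S = map′ mem holds (T? (S v))

_⊆_ : VertexSet n → VertexSet n → Set
S ⊆ R = ∀ {v} → v ∈ S → v ∈ R

_∩_ _∖_ : VertexSet n → VertexSet n → VertexSet n
(S ∩ R) v = S v ∧ R v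
(S ∖ R) v = S v ∧ not (R v)

T-not⁺ : ∀ {b} → ¬ T b → T (not b)
T-not⁺ {false} _ = tt
T-not⁺ {true}  ¬t = ¬t tt

T-not⁻ : ∀ {b} → T (not b) → ¬ T b
T-not⁻ {false} _ ()

∈-∩⁺ : ∀ {S R : VertexSet n} {v} → v ∈ S → v ∈ R → v ∈ S ∩ R
∈-∩⁺ (mem p) (mem q) = mem (Equivalence.from T-∧ (p , q))

∈-∩⁻ : ∀ (S R : VertexSet n) {v} → v ∈ S ∩ R → v ∈ S × v ∈ R
∈-∩⁻ S R (mem p) = Product.map mem mem (Equivalence.to T-∧ p)

∈-∖⁺ : ∀ {S R : VertexSet n} {v} → v ∈ S → v ∉ R → v ∈ S ∖ R
∈-∖⁺ (mem p) q = mem (Equivalence.from T-∧ (p , T-not⁺ (q ∘ mem)))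

∈-∖⁻ : ∀ (S R : VertexSet n) {v} → v ∈ S ∖ R → v ∈ S × v ∉ R
∈-∖⁻ S R (mem p) = Product.map mem (λ q → T-not⁻ q ∘ holds) (Equivalence.to T-∧ p)

T-ext : ∀ {a b} → (T a → T b) → (T b → T a) → a ≡ b
T-ext {false} {false} _ _ = refl
T-ext {false} {true}  _ g = ⊥-elim (g tt)
T-ext {true}  {false} f _ = ⊥-elim (f tt)
T-ext {true}  {true}  _ _ = refl

ι : Bool → ℕ
ι b = if b then 1 else 0

ι-mono : ∀ {a b} → (T a → T b) → ι a ≤ ι b
ι-mono {false}         _ = z≤n
ι-mono {true}  {false} f = ⊥-elim (f tt)
ι-mono {true}  {true}  _ = s≤s z≤n

ι-mono-< : ∀ {a b} → ¬ T a → T b → ι a < ι b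
ι-mono-< {false} {true} _  _ = s≤s z≤n
ι-mono-< {true}         ¬a _ = ⊥-elim (¬a tt)

ι-∧ : ∀ a b → ι (a ∧ b) ≡ ι a * ι b
ι-∧ false b = refl
ι-∧ true  b = sym (+-identityʳ (ι b))

count : VertexSet n → ℕ
count S = sum (ι ∘ S)

count-cong : {S R : VertexSet n} → S ⊆ R → R ⊆ S → count S ≡ count R
count-cong S⊆R R⊆S = sum-cong-≗ (λ v → cong ι (T-ext (holds ∘ S⊆R {v} ∘ mem) (holds ∘ R⊆S {v} ∘ mem)))

count-mono-≤ : {S R : VertexSet n} → S ⊆ R → count S ≤ count R
count-mono-≤ S⊆R = sum-mono-≤ (λ v → ι-mono (holds ∘ S⊆R {v} ∘ mem))

count-mono-< : {S R : VertexSet n} → S ⊆ R → ∀ {v} → v ∉ S → v ∈ R → count S < count R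
count-mono-< S⊆R {v₀} v∉S v∈R =
  sum-mono-< (λ v → ι-mono (holds ∘ S⊆R {v} ∘ mem)) v₀ (ι-mono-< (v∉S ∘ mem) (holds v∈R))

count-∖ : {S U : VertexSet n} → S ⊆ U → count S + count (U ∖ S) ≡ count U
count-∖ {S = S} {U} S⊆U =
  trans (sym (∑-distrib-+ (ι ∘ S) (ι ∘ (U ∖ S)))) (sum-cong-≗ (λ v → split (S v) (U v) (holds ∘ S⊆U ∘ mem)))
  where
  split : ∀ s u → (T s → T u) → ι s + ι (u ∧ not s) ≡ ι u
  split false false _ = refl
  split false true  _ = refl
  split true  false f = ⊥-elim (f tt)
  split true  true  _ = refl

-- Adjacency or equality: A v is the closed neighbourhood of v.
Adjacency : ℕ → Set
Adjacency n = Fin n → Fin n → Bool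

private variable
  A : Adjacency n
  U : VertexSet n

-- Deviation and the deletion of a clique.

Clique : Adjacency n → VertexSet n → Set
Clique A S = ∀ {u v} → u ∈ S → v ∈ S → v ∈ A u

deg : Adjacency n → VertexSet n → Fin n → ℕ
deg A U v = count (U ∩ A v)

-- Vertices are deleted by shrinking `U` while the type `Fin n` stays fixed; the factor `ι (U v)`
-- and the intersection in `deg` make this the sum for the subgraph induced on `U`.
deviation : ℕ → Adjacency n → VertexSet n → ℕ
deviation K A U = sum (λ v → ι (U v) * ∣ deg A U v - K ∣)

∣m+n-m∣≡n : ∀ m n → ∣ m + n - m ∣ ≡ n
∣m+n-m∣≡n m n = trans (∣-∣-comm (m + n) m) (∣m-m+n∣≡n m n)

-- For a vertex outside a deleted clique, which loses its `a` neighbours there.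
∣-∣-shift : ∀ a b K → ∣ b - K ∣ ≤ ∣ a + b - K ∣ + a
∣-∣-shift a b K = begin
  ∣ b - K ∣                     ≤⟨ ∣-∣-triangle b (a + b) K ⟩
  ∣ b - a + b ∣ + ∣ a + b - K ∣ ≡⟨ cong (_+ ∣ a + b - K ∣) (trans (cong (∣ b -_∣) (+-comm a b)) (∣m-m+n∣≡n b a)) ⟩
  a + ∣ a + b - K ∣             ≡⟨ +-comm a _ ⟩
  ∣ a + b - K ∣ + a             ∎
  where open ≤-Reasoning

-- Double counting of the adjacent pairs with one vertex in `S` and the other in `R`.
edges-between : (A : Adjacency n) → (∀ u v → A u v ≡ A v u) → ∀ S R →
  sum (λ v → ι (S v) * deg A R v) ≡ sum (λ v → ι (R v) * deg A S v)
edges-between A A-sym S R = begin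
  sum (λ v → ι (S v) * deg A R v)
    ≡⟨ sum-cong-≗ (λ v → *-distribˡ-sum (ι (S v)) (ι ∘ (R ∩ A v))) ⟩
  sum (λ v → sum (λ u → ι (S v) * ι (R u ∧ A v u)))
    ≡⟨ ∑-comm (λ v u → ι (S v) * ι (R u ∧ A v u)) ⟩
  sum (λ u → sum (λ v → ι (S v) * ι (R u ∧ A v u)))
    ≡⟨ sum-cong-≗ (λ u → sum-cong-≗ (λ v → swap-factors u v)) ⟩
  sum (λ u → sum (λ v → ι (R u) * ι (S v ∧ A u v)))
    ≡⟨ sum-cong-≗ (λ u → *-distribˡ-sum (ι (R u)) (ι ∘ (S ∩ A u))) ⟨
  sum (λ u → ι (R u) * deg A S u) ∎
  where
  open ≡-Reasoning
  swap-factors : ∀ u v → ι (S v) * ι (R u ∧ A v u) ≡ ι (R u) * ι (S v ∧ A u v)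
  swap-factors u v rewrite ι-∧ (R u) (A v u) | ι-∧ (S v) (A u v) | A-sym u v =
    lemma (ι (S v)) (ι (R u)) (ι (A v u))
    where
    lemma : ∀ a b c → a * (b * c) ≡ b * (a * c)
    lemma = solve-∀

-- Deleting `S` raises the term of a vertex outside by at most the number of its neighbours in `S`.
-- Inside `S` a term is exactly `t` plus the number of neighbours outside. By `edges-between` both
-- corrections sum to `E`, which cancels, and the `K + t` vertices of `S` contribute `t` each.
deviation-∖ : ∀ K t {A : Adjacency n} {U S} → (∀ u v → A u v ≡ A v u) →
  S ⊆ U → Clique A S → count S ≡ K + t →
  deviation K A (U ∖ S) + (K + t) * t ≤ deviation K A U
deviation-∖ {n} K t {A} {U} {S} A-sym S⊆U clique |S| = +-cancelʳ-≤ E _ _ (begin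
  deviation K A R + (K + t) * t + E
    ≡⟨ cong (λ s → deviation K A R + s + E) (trans (cong (_* t) (sym |S|)) (*-distribʳ-sum t (ι ∘ S))) ⟩
  deviation K A R + sum (λ v → ι (S v) * t) + E
    ≡⟨ +-assoc (deviation K A R) _ E ⟩
  deviation K A R + (sum (λ v → ι (S v) * t) + E)
    ≡⟨ cong (deviation K A R +_) (∑-distrib-+ (λ v → ι (S v) * t) _) ⟨
  deviation K A R + sum (λ v → ι (S v) * t + ι (S v) * deg A R v)
    ≡⟨ ∑-distrib-+ (λ v → ι (R v) * ∣ deg A R v - K ∣) _ ⟨
  sum (λ v → ι (R v) * ∣ deg A R v - K ∣ + (ι (S v) * t + ι (S v) * deg A R v))
    ≤⟨ sum-mono-≤ (λ v → pointwise (U v) (S v) (holds ∘ S⊆U ∘ mem) (deg-split v) (deg-clique v ∘ mem)) ⟩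
  sum (λ v → ι (U v) * ∣ deg A U v - K ∣ + ι (R v) * deg A S v)
    ≡⟨ ∑-distrib-+ (λ v → ι (U v) * ∣ deg A U v - K ∣) _ ⟩
  deviation K A U + sum (λ v → ι (R v) * deg A S v)
    ≡⟨ cong (deviation K A U +_) (edges-between A A-sym S R) ⟨
  deviation K A U + E ∎)
  where
  open ≤-Reasoning
  R = U ∖ S
  E = sum (λ v → ι (S v) * deg A R v)
  deg-clique : ∀ v → v ∈ S → deg A S v ≡ K + t
  deg-clique v v∈S = trans
    (count-cong {S = S ∩ A v} (proj₁ ∘ ∈-∩⁻ S (A v)) (λ u∈S → ∈-∩⁺ {S = S} {A v} u∈S (clique v∈S u∈S))) |S|
  split : ∀ u s a → (T s → T u) → ι (u ∧ a) ≡ ι (s ∧ a) + ι ((u ∧ not s) ∧ a)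
  split false false a _ = refl
  split false true  a f = ⊥-elim (f tt)
  split true  false a _ = refl
  split true  true  a _ = sym (+-identityʳ (ι a))
  deg-split : ∀ v → deg A U v ≡ deg A S v + deg A R v
  deg-split v = trans (sum-cong-≗ (λ u → split (U u) (S u) (A v u) (holds ∘ S⊆U ∘ mem))) (∑-distrib-+ (ι ∘ (S ∩ A v)) _)
  pointwise : ∀ u s {dS dR dU} → (T s → T u) → dU ≡ dS + dR → (T s → dS ≡ K + t) →
    ι (u ∧ not s) * ∣ dR - K ∣ + (ι s * t + ι s * dR) ≤ ι u * ∣ dU - K ∣ + ι (u ∧ not s) * dS
  pointwise false false _ _ _ = z≤n
  pointwise false true  f _ _ = ⊥-elim (f tt)
  pointwise true  false {dS} {dR} _ refl _
    rewrite +-identityʳ (∣ dR - K ∣ + 0) | +-identityʳ ∣ dR - K ∣ | +-identityʳ ∣ dS + dR - K ∣ | +-identityʳ dS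
    = ∣-∣-shift dS dR K
  pointwise true  true  {dR = dR} _ refl dS≡ rewrite dS≡ tt
    | +-assoc K t dR | ∣m+n-m∣≡n K (t + dR) | +-identityʳ t | +-identityʳ dR
    | +-identityʳ (t + dR) | +-identityʳ (t + dR) = ≤-refl

setOf : {P : Fin n → Set} → (∀ v → Dec (P v)) → VertexSet n
setOf P? v = does (P? v)

∈-setOf⁺ : {P : Fin n → Set} (P? : ∀ v → Dec (P v)) → ∀ {v} → P v → v ∈ setOf P?
∈-setOf⁺ P? {v} p = mem (subst T (sym (dec-true (P? v) p)) tt)

∈-setOf⁻ : {P : Fin n → Set} (P? : ∀ v → Dec (P v)) → ∀ {v} → v ∈ setOf P? → P v
∈-setOf⁻ P? {v} (mem t) with P? v
... | yes p = p

-- Chordality and simplicial cliques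

-- Both ends are recorded so that walks can be reversed. An empty walk carries no membership, which
-- is why `detour` asks for that of `c` separately.
record Link (A : Adjacency n) (Q : VertexSet n) (a b : Fin n) : Set where
  constructor link
  field
    source∈  : a ∈ Q
    target∈  : b ∈ Q
    adjacent : b ∈ A a

Walk : Adjacency n → VertexSet n → Fin n → Fin n → Set
Walk A Q = Star (Link A Q)

Walk-mono : ∀ {Q R : VertexSet n} → Q ⊆ R → ∀ {a b} → Walk A Q a b → Walk A R a b
Walk-mono Q⊆R = Star.map λ (link a∈ b∈ ab) → link (Q⊆R a∈) (Q⊆R b∈) ab

-- Two neighbours of `v` joined by a path whose interior avoids N[v] are adjacent or equal, since
-- otherwise a shortest such path would form a hole with `v`. Walks may pause and repeat vertices,
-- so this form passes easily to subgraphs and to the enlarged graph `A⁺`.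
record IsChordal (A : Adjacency n) (U : VertexSet n) : Set where
  field
    A-sym  : ∀ u v → A u v ≡ A v u
    A-refl : ∀ v → v ∈ A v
    detour : ∀ {v x y c d} → v ∈ U → x ∈ U → y ∈ U → x ∈ A v → y ∈ A v →
      c ∈ U ∖ A v → Walk A (U ∖ A v) c d → c ∈ A x → y ∈ A d → y ∈ A x

  symmetric : ∀ {u v} → v ∈ A u → u ∈ A v
  symmetric (mem t) = mem (subst T (A-sym _ _) t)

  reverse : ∀ {Q a b} → Walk A Q a b → Walk A Q b a
  reverse = Star.reverse λ (link a∈ b∈ ab) → link b∈ a∈ (symmetric ab)

IsChordal-⊆ : ∀ {R} → R ⊆ U → IsChordal A U → IsChordal A R
IsChordal-⊆ {U = U} {A = A} {R} R⊆U ch = record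
  { A-sym = A-sym
  ; A-refl = A-refl
  ; detour = λ {v} v∈ x∈ y∈ vx vy c∈ walk → detour (R⊆U v∈) (R⊆U x∈) (R⊆U y∈) vx vy
      (inclusion v c∈) (Walk-mono (inclusion v) walk)
  }
  where
  open IsChordal ch
  inclusion : ∀ v → R ∖ A v ⊆ U ∖ A v
  inclusion v w∈ = let w∈R , vw = ∈-∖⁻ R (A v) w∈ in ∈-∖⁺ (R⊆U w∈R) vw

-- `x` witnesses that `X` is nonempty, so that joining `X` to `y` adds an edge: by `X-closed` and
-- `y∉S`, `y` has no neighbour in `X` yet.
record Leaf (A : Adjacency n) (U : VertexSet n) : Set where
  field
    X S       : VertexSet n
    x y       : Fin n
    x∈X       : x ∈ X
    X⊆S       : X ⊆ S
    S⊆U       : S ⊆ U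
    S-clique  : Clique A S
    X-closed  : ∀ {u w} → u ∈ X → w ∈ U → w ∈ A u → w ∈ S
    y∈U       : y ∈ U
    y∉S       : y ∉ S
    y-adj     : ∀ {w} → w ∈ S → w ∉ X → y ∈ A w

-- A search from `c`: `D` holds the vertices reached so far and grows while an edge leads from it to
-- the rest of `W`. If it stops early, `D` is a smaller set for `leaf` to continue with; otherwise
-- `W` is connected.
reach : (A : Adjacency n) (W : VertexSet n) {c : Fin n} → ∀ D → Acc _<_ (count (W ∖ D)) →
  c ∈ D → D ⊆ W → (∀ {u} → u ∈ D → Walk A W c u) →
  (∀ {u} → u ∈ W → Walk A W c u) ⊎
  (∃ λ D → c ∈ D × D ⊆ W × (∃ λ w → w ∈ W × w ∉ D) × (∀ {u w} → u ∈ D → w ∈ W → w ∈ A u → w ∈ D))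
reach A W {c} D (acc smaller) c∈D D⊆W walks
  with Fin.any? (λ w → (w ∈? W) ×-dec ¬? (w ∈? D))
... | no D=W = inj₁ (λ {u} u∈W → walks (decidable-stable (u ∈? D) λ u∉D → D=W (u , u∈W , u∉D)))
... | yes outside
  with Fin.any? (λ u → Fin.any? (λ w → (u ∈? D) ×-dec (w ∈? W) ×-dec ¬? (w ∈? D) ×-dec (w ∈? A u)))
... | no closed = inj₂ (D , c∈D , D⊆W , outside , λ {u} {w} u∈D w∈W uw →
        decidable-stable (w ∈? D) λ w∉D → closed (u , w , u∈D , w∈W , w∉D , uw))
... | yes (u , w , u∈D , w∈W , w∉D , uw) =
  reach A W D′ (smaller (count-mono-< shrink {w} (λ w∈ → proj₂ (∈-∖⁻ W D′ w∈) w∈D′) (∈-∖⁺ w∈W w∉D)))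
    (D⊆D′ c∈D) (D′-elim _ D⊆W λ { refl → w∈W })
    (D′-elim (Walk A W c) walks λ { refl → walks u∈D ◅◅ link (D⊆W u∈D) w∈W uw ◅ ε })
  where
  D′? = λ a → (a ∈? D) ⊎-dec (a Fin.≟ w)
  D′ = setOf D′?
  D⊆D′ : D ⊆ D′
  D⊆D′ = ∈-setOf⁺ D′? ∘ inj₁
  w∈D′ : w ∈ D′
  w∈D′ = ∈-setOf⁺ D′? (inj₂ refl)
  shrink : W ∖ D′ ⊆ W ∖ D
  shrink a∈ = let a∈W , a∉D′ = ∈-∖⁻ W D′ a∈ in ∈-∖⁺ a∈W (a∉D′ ∘ D⊆D′)
  D′-elim : (P : Fin _ → Set) → (∀ {a} → a ∈ D → P a) → (∀ {a} → a ≡ w → P a) → ∀ {a} → a ∈ D′ → P a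
  D′-elim P f g = [ f , g ]′ ∘ ∈-setOf⁻ D′?

-- Lets `p` take the place of `v`: neighbours of `W` in N[v] also lie in N[p], so the part of `W`
-- outside N[p] is a union of components of `U` minus N[p].
closed-∖ : ∀ {v} W p → (∀ {u w} → u ∈ W → w ∈ U → w ∈ A u → w ∈ A v ⊎ w ∈ W) →
  (∀ {u w} → u ∈ W → w ∈ U → w ∈ A u → w ∈ A v → w ∈ A p) →
  ∀ {u w} → u ∈ W ∖ A p → w ∈ U → w ∈ A u → w ∈ A p ⊎ w ∈ W ∖ A p
closed-∖ {A = A} W p closed absorb {w = w} u∈ w∈U uw with w ∈? A p
... | yes pw = inj₁ pw
... | no p≁w = let u∈W , _ = ∈-∖⁻ W (A p) u∈ in
  [ inj₁ ∘ absorb u∈W w∈U uw , (λ w∈W → inj₂ (∈-∖⁺ w∈W p≁w)) ]′ (closed u∈W w∈U uw)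

-- W is a union of components of U minus N[v]; a smallest such W is a component, and
-- W together with its attachments in N(v) is a clique.
leaf : IsChordal A U → ∀ v W → Acc _<_ (count W) → v ∈ U → W ⊆ U ∖ A v → (∃ λ c → c ∈ W) →
  (∀ {u w} → u ∈ W → w ∈ U → w ∈ A u → w ∈ A v ⊎ w ∈ W) → Leaf A U
leaf {A = A} {U = U} ch v W (acc smaller) v∈U W⊆ (c , c∈W) closed
  with reach A W (setOf (Fin._≟ c)) (<-wellFounded _) (∈-setOf⁺ (Fin._≟ c) refl)
         (λ u∈ → subst (_∈ W) (sym (∈-setOf⁻ (Fin._≟ c) u∈)) c∈W)
         (λ u∈ → subst (Walk A W c) (sym (∈-setOf⁻ (Fin._≟ c) u∈)) ε)
... | inj₂ (D , c∈D , D⊆W , (w , w∈W , w∉D) , D-closed) =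
  leaf ch v D (smaller (count-mono-< D⊆W w∉D w∈W)) v∈U (W⊆ ∘ D⊆W) (c , c∈D)
    (λ u∈D w∈U uw → Sum.map₂ (λ w∈W → D-closed u∈D w∈W uw) (closed (D⊆W u∈D) w∈U uw))
... | inj₁ walks
  with Fin.any? (λ b → Fin.any? (λ d → Fin.any? (λ e →
         (b ∈? U) ×-dec (b ∈? A v) ×-dec (d ∈? W) ×-dec (d ∈? A b) ×-dec (e ∈? W) ×-dec ¬? (e ∈? A b))))
-- The attachment `b` misses some `e` in `W`, so it takes the place of `v`. As `W` is connected,
-- `detour` through `W` makes every other attachment adjacent to `b`.
... | yes (b , d , e , b∈U , vb , d∈W , bd , e∈W , b≁e) =
  leaf ch b (W ∖ A b)
    (smaller (count-mono-< (proj₁ ∘ ∈-∖⁻ W (A b)) {d} (λ d∈ → proj₂ (∈-∖⁻ W (A b) d∈) bd) d∈W))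
    b∈U
    (λ u∈ → let u∈W , b≁u = ∈-∖⁻ W (A b) u∈ in ∈-∖⁺ (proj₁ (∈-∖⁻ U (A v) (W⊆ u∈W))) b≁u)
    (e , ∈-∖⁺ e∈W b≁e)
    (closed-∖ W b closed λ u∈W w∈U uw vw →
      detour v∈U b∈U w∈U vb vw (W⊆ d∈W) (Walk-mono W⊆ (reverse (walks d∈W) ◅◅ walks u∈W)) bd uw)
  where open IsChordal ch
... | no B-complete
  with Fin.any? (λ d → Fin.any? (λ e → (d ∈? W) ×-dec (e ∈? W) ×-dec ¬? (e ∈? A d)))
-- Now every attachment is adjacent to all of `W`. If `W` is not a clique, its vertex `d` takes the
-- place of `v`, and all attachments lie in N[d].
... | yes (d , e , d∈W , e∈W , d≁e) =
  leaf ch d (W ∖ A d)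
    (smaller (count-mono-< (proj₁ ∘ ∈-∖⁻ W (A d)) {d} (λ d∈ → proj₂ (∈-∖⁻ W (A d) d∈) (A-refl d)) d∈W))
    (proj₁ (∈-∖⁻ U (A v) (W⊆ d∈W)))
    (λ u∈ → let u∈W , d≁u = ∈-∖⁻ W (A d) u∈ in ∈-∖⁺ (proj₁ (∈-∖⁻ U (A v) (W⊆ u∈W))) d≁u)
    (e , ∈-∖⁺ e∈W d≁e)
    (closed-∖ W d closed λ {u} {w} u∈W w∈U uw vw → symmetric (decidable-stable (d ∈? A w) λ w≁d →
      B-complete (w , u , d , w∈U , vw , u∈W , symmetric uw , d∈W , w≁d)))
  where open IsChordal ch
... | no W-complete = record
  { X = W
  ; S = S
  ; x = c
  ; y = v
  ; x∈X = c∈W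
  ; X⊆S = ∈-setOf⁺ S? ∘ inj₁
  ; S⊆U = [ (λ u∈W → proj₁ (∈-∖⁻ U (A v) (W⊆ u∈W))) , proj₁ ]′ ∘ ∈-setOf⁻ S?
  ; S-clique = λ u∈ w∈ → S-clique (∈-setOf⁻ S? u∈) (∈-setOf⁻ S? w∈)
  ; X-closed = λ u∈W w∈U uw → ∈-setOf⁺ S?
      ([ (λ vw → inj₂ (w∈U , vw , _ , u∈W , symmetric uw)) , inj₁ ]′ (closed u∈W w∈U uw))
  ; y∈U = v∈U
  ; y∉S = [ (λ v∈W → proj₂ (∈-∖⁻ U (A v) (W⊆ v∈W)) (A-refl v))
          , (λ (_ , _ , d , d∈W , vd) → proj₂ (∈-∖⁻ U (A v) (W⊆ d∈W)) vd) ]′ ∘ ∈-setOf⁻ S?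
  ; y-adj = λ w∈S w∉W → [ (λ w∈W → contradiction w∈W w∉W) , symmetric ∘ proj₁ ∘ proj₂ ]′ (∈-setOf⁻ S? w∈S)
  }
  where
  open IsChordal ch
  B : Fin _ → Set
  B b = b ∈ U × b ∈ A v × ∃ λ d → d ∈ W × d ∈ A b
  S? = λ w → (w ∈? W) ⊎-dec ((w ∈? U) ×-dec (w ∈? A v) ×-dec Fin.any? (λ d → (d ∈? W) ×-dec (d ∈? A w)))
  S = setOf S?
  B-W : ∀ {b e} → B b → e ∈ W → e ∈ A b
  B-W {b} {e} (b∈U , vb , d , d∈W , bd) e∈W = decidable-stable (e ∈? A b) λ b≁e →
    B-complete (b , d , e , b∈U , vb , d∈W , bd , e∈W , b≁e)
  S-clique : ∀ {u w} → u ∈ W ⊎ B u → w ∈ W ⊎ B w → w ∈ A u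
  S-clique {u} {w} (inj₁ u∈W) (inj₁ w∈W) = decidable-stable (w ∈? A u) λ u≁w → W-complete (u , w , u∈W , w∈W , u≁w)
  S-clique (inj₁ u∈W) (inj₂ w∈B) = symmetric (B-W w∈B u∈W)
  S-clique (inj₂ u∈B) (inj₁ w∈W) = B-W u∈B w∈W
  -- Any two attachments have the common neighbour `d` in `W`; the walk of the detour is this single
  -- vertex.
  S-clique (inj₂ (u∈U , vu , d , d∈W , ud)) (inj₂ w∈B@(w∈U , vw , _)) =
    detour v∈U u∈U w∈U vu vw (W⊆ d∈W) ε ud (symmetric (B-W w∈B d∈W))

clique-or-leaf : IsChordal A U → Clique A U ⊎ Leaf A U
clique-or-leaf {A = A} {U = U} ch
  with Fin.any? (λ v → Fin.any? (λ w → (v ∈? U) ×-dec (w ∈? U) ×-dec ¬? (w ∈? A v)))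
... | no complete = inj₁ λ {u} {v} u∈U v∈U → decidable-stable (v ∈? A u) λ u≁v → complete (u , v , u∈U , v∈U , u≁v)
... | yes (v , w , v∈U , w∈U , v≁w) = inj₂ (leaf ch v (U ∖ A v) (<-wellFounded _) v∈U id (w , ∈-∖⁺ w∈U v≁w) closed)
  where
  closed : ∀ {a b} → a ∈ U ∖ A v → b ∈ U → b ∈ A a → b ∈ A v ⊎ b ∈ U ∖ A v
  closed {b = b} _ b∈U _ with b ∈? A v
  ... | yes vb = inj₁ vb
  ... | no v≁b = inj₂ (∈-∖⁺ b∈U v≁b)

sum-≟ : ∀ (y : Fin n) → sum (λ v → ι (does (v Fin.≟ y))) ≡ 1
sum-≟ {suc n} zero    = cong suc (sum-replicate-zero n)
sum-≟ {suc n} (suc y) = sum-≟ y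

-- The deviation of a chordal graph

-- The number of ordered pairs of nonadjacent vertices in `U`: a termination measure for adding
-- edges while `U` stays the same.
gaps : Adjacency n → VertexSet n → ℕ
gaps A U = sum (λ v → ι (U v) * count (U ∖ A v))

-- Meant for `deg⁺`: an adjacency in `A⁺` is old or a new edge in one of two directions, and these
-- exclude each other, so their indicators add up.
ι-∧-∨ : ∀ p q a b → (T a → T p) → (T b → T p) → (T q → T a → ⊥) → (T q → T b → ⊥) → (T a → T b → ⊥) →
  ι (p ∧ (q ∨ (a ∨ b))) ≡ ι (p ∧ q) + (ι a + ι b)
ι-∧-∨ false _     true  _     f _ _ _ _ = ⊥-elim (f tt)
ι-∧-∨ false _     false true  _ f _ _ _ = ⊥-elim (f tt)
ι-∧-∨ false _     false false _ _ _ _ _ = refl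
ι-∧-∨ true  true  true  _     _ _ f _ _ = ⊥-elim (f tt tt)
ι-∧-∨ true  true  false true  _ _ _ f _ = ⊥-elim (f tt tt)
ι-∧-∨ true  true  false false _ _ _ _ _ = refl
ι-∧-∨ true  false true  true  _ _ _ _ f = ⊥-elim (f tt tt)
ι-∧-∨ true  false true  false _ _ _ _ _ = refl
ι-∧-∨ true  false false true  _ _ _ _ _ = refl
ι-∧-∨ true  false false false _ _ _ _ _ = refl

-- Joining `X` to `y`.

module Attach {n} {A : Adjacency n} {U : VertexSet n} (ch : IsChordal A U) (ℓ : Leaf A U) where
  open IsChordal ch
  open Leaf ℓ

  NewEdge : Fin n → Fin n → Set
  NewEdge u v = (u ∈ X × v ≡ y) ⊎ (u ≡ y × v ∈ X)

  A⁺? : ∀ u v → Dec (v ∈ A u ⊎ NewEdge u v)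
  A⁺? u v = (v ∈? A u) ⊎-dec (((u ∈? X) ×-dec (v Fin.≟ y)) ⊎-dec ((u Fin.≟ y) ×-dec (v ∈? X)))

  A⁺ : Adjacency n
  A⁺ u = setOf (A⁺? u)

  from⁺ : ∀ {u v} → v ∈ A⁺ u → v ∈ A u ⊎ NewEdge u v
  from⁺ {u} = ∈-setOf⁻ (A⁺? u)

  to⁺ : ∀ {u v} → v ∈ A u ⊎ NewEdge u v → v ∈ A⁺ u
  to⁺ {u} = ∈-setOf⁺ (A⁺? u)

  y∉X : y ∉ X
  y∉X = y∉S ∘ X⊆S

  symmetric⁺ : ∀ {u v} → v ∈ A⁺ u → u ∈ A⁺ v
  symmetric⁺ = to⁺ ∘ Sum.map symmetric (Sum.swap ∘ Sum.map Product.swap Product.swap) ∘ from⁺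

  old : ∀ {u v} → u ∉ X → v ∉ X → v ∈ A⁺ u → v ∈ A u
  old u∉X v∉X uv with from⁺ uv
  ... | inj₁ uv = uv
  ... | inj₂ (inj₁ (u∈X , _)) = contradiction u∈X u∉X
  ... | inj₂ (inj₂ (_ , v∈X)) = contradiction v∈X v∉X

  nbr-of-X : ∀ {x u} → x ∈ X → u ∈ U → u ∈ A⁺ x → u ∈ S ⊎ u ≡ y
  nbr-of-X x∈X u∈U xu with from⁺ xu
  ... | inj₁ xu = inj₁ (X-closed x∈X u∈U xu)
  ... | inj₂ (inj₁ (_ , u≡y)) = inj₂ u≡y
  ... | inj₂ (inj₂ (_ , u∈X)) = inj₁ (X⊆S u∈X)

  y-S : ∀ {w} → w ∈ S → y ∈ A⁺ w
  y-S {w} w∈S with w ∈? X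
  ... | yes w∈X = to⁺ (inj₂ (inj₁ (w∈X , refl)))
  ... | no w∉X = to⁺ (inj₁ (y-adj w∈S w∉X))

  -- In `A⁺` the neighbours of a vertex of `X` lie in the clique `S` or equal `y`, and `y` is now
  -- adjacent to all of `S`.
  simplicial : ∀ {x u w} → x ∈ X → u ∈ U → w ∈ U → u ∈ A⁺ x → w ∈ A⁺ x → w ∈ A⁺ u
  simplicial x∈X u∈U w∈U xu xw with nbr-of-X x∈X u∈U xu | nbr-of-X x∈X w∈U xw
  ... | inj₁ u∈S  | inj₁ w∈S  = to⁺ (inj₁ (S-clique u∈S w∈S))
  ... | inj₁ u∈S  | inj₂ refl = y-S u∈S
  ... | inj₂ refl | inj₁ w∈S  = symmetric⁺ (y-S w∈S)
  ... | inj₂ refl | inj₂ refl = to⁺ (inj₁ (A-refl _))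

  -- Vertices of X can be skipped on a walk, their neighbourhoods being cliques.
  avoid-X : ∀ {v a c d b} → a ∈ U → b ∈ U → c ∈ U ∖ A⁺ v → Walk A⁺ (U ∖ A⁺ v) c d → c ∈ A⁺ a → b ∈ A⁺ d →
    b ∈ A⁺ a ⊎ ∃₂ λ c′ d′ → c′ ∈ A⁺ a × b ∈ A⁺ d′ × c′ ∉ X × d′ ∉ X ×
      c′ ∈ U ∖ A⁺ v × d′ ∈ U ∖ A⁺ v × Walk A (U ∖ A v) c′ d′
  avoid-X {v} {a} {c} a∈U b∈U c∈ walk ac db with c ∈? X | walk
  ... | yes c∈X | ε = inj₁ (simplicial c∈X a∈U b∈U (symmetric⁺ ac) db)
  ... | yes c∈X | link _ e∈ ce ◅ rest =
    avoid-X a∈U b∈U e∈ rest (simplicial c∈X a∈U (proj₁ (∈-∖⁻ U (A⁺ v) e∈)) (symmetric⁺ ac) ce) db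
  ... | no c∉X | ε = inj₂ (_ , _ , ac , db , c∉X , c∉X , c∈ , c∈ , ε)
  ... | no c∉X | link _ e∈ ce ◅ rest with avoid-X (proj₁ (∈-∖⁻ U (A⁺ v) c∈)) b∈U e∈ rest ce db
  -- All later vertices have been skipped, so `c` is also the last one kept.
  ... | inj₁ cb = inj₂ (_ , _ , ac , cb , c∉X , c∉X , c∈ , c∈ , ε)
  ... | inj₂ (c′ , d′ , cc′ , d′b , c′∉X , d′∉X , c′∈ , d′∈ , rest′) =
    inj₂ (_ , _ , ac , d′b , c∉X , d′∉X , c∈ , d′∈ , link (inclusion c∈) (inclusion c′∈) (old c∉X c′∉X cc′) ◅ rest′)
    where
    inclusion : U ∖ A⁺ v ⊆ U ∖ A v
    inclusion w∈ = let w∈U , vw = ∈-∖⁻ U (A⁺ v) w∈ in ∈-∖⁺ w∈U (vw ∘ to⁺ ∘ inj₁)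

  chordal⁺ : IsChordal A⁺ U
  chordal⁺ = record
    { A-sym = λ u v → T-ext (holds ∘ symmetric⁺ ∘ mem) (holds ∘ symmetric⁺ ∘ mem)
    ; A-refl = λ v → to⁺ (inj₁ (A-refl v))
    ; detour = detour⁺
    }
    where
    detour⁺ : ∀ {v x y c d} → v ∈ U → x ∈ U → y ∈ U → x ∈ A⁺ v → y ∈ A⁺ v →
      c ∈ U ∖ A⁺ v → Walk A⁺ (U ∖ A⁺ v) c d → c ∈ A⁺ x → y ∈ A⁺ d → y ∈ A⁺ x
    detour⁺ {v} {a} {b} v∈U a∈U b∈U va vb c∈ walk ac db with avoid-X a∈U b∈U c∈ walk ac db
    ... | inj₁ ab = ab
    ... | inj₂ (c , d , ac , db , c∉X , d∉X , c∈ , d∈ , walk)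
      with v ∈? X | a ∈? X | b ∈? X | ∈-∖⁻ U (A⁺ v) c∈ | ∈-∖⁻ U (A⁺ v) d∈
    ... | yes v∈X | _ | _ | _ | _ = simplicial v∈X a∈U b∈U va vb
    -- If `a ∈ X`, its neighbours `v` and `c` would be adjacent, although `c` avoids N[v]; likewise
    -- for `b` and `d` below.
    ... | no _ | yes a∈X | _ | c∈U , vc | _ =
      contradiction (simplicial a∈X v∈U c∈U (symmetric⁺ va) ac) vc
    ... | no _ | no _ | yes b∈X | _ | d∈U , vd =
      contradiction (simplicial b∈X v∈U d∈U (symmetric⁺ vb) (symmetric⁺ db)) vd
    -- No vertex of `X` is involved any more, so every adjacency is old and the original `detour`
    -- applies.
    ... | no v∉X | no a∉X | no b∉X | c∈U , vc | _ =
      to⁺ (inj₁ (detour v∈U a∈U b∈U (old v∉X a∉X va) (old v∉X b∉X vb)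
        (∈-∖⁺ c∈U (vc ∘ to⁺ ∘ inj₁)) walk (old a∉X c∉X ac) (old d∉X b∉X db)))

  δ : Fin n → Bool
  δ v = does (v Fin.≟ y)

  deg⁺ : ∀ v → deg A⁺ U v ≡ deg A U v + (ι (X v) + ι (δ v) * count X)
  deg⁺ v = begin
    deg A⁺ U v
      ≡⟨ sum-cong-≗ pointwise ⟩
    sum (λ u → ι (U u ∧ A v u) + (ι (X v) * ι (δ u) + ι (δ v) * ι (X u)))
      ≡⟨ ∑-distrib-+ (ι ∘ (U ∩ A v)) _ ⟩
    deg A U v + sum (λ u → ι (X v) * ι (δ u) + ι (δ v) * ι (X u))
      ≡⟨ cong (deg A U v +_) (∑-distrib-+ (λ u → ι (X v) * ι (δ u)) _) ⟩
    deg A U v + (sum (λ u → ι (X v) * ι (δ u)) + sum (λ u → ι (δ v) * ι (X u)))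
      ≡⟨ cong (deg A U v +_) (cong₂ _+_ (*-distribˡ-sum (ι (X v)) (ι ∘ δ)) (*-distribˡ-sum (ι (δ v)) (ι ∘ X))) ⟨
    deg A U v + (ι (X v) * sum (ι ∘ δ) + ι (δ v) * count X)
      ≡⟨ cong (λ s → deg A U v + (s + ι (δ v) * count X)) (trans (cong (ι (X v) *_) (sum-≟ y)) (*-identityʳ _)) ⟩
    deg A U v + (ι (X v) + ι (δ v) * count X) ∎
    where
    open ≡-Reasoning
    x≁y : ∀ {x} → x ∈ X → y ∉ A x
    x≁y x∈X xy = y∉S (X-closed x∈X y∈U xy)
    pointwise : ∀ u → ι (U u ∧ A⁺ v u) ≡ ι (U u ∧ A v u) + (ι (X v) * ι (δ u) + ι (δ v) * ι (X u))
    pointwise u rewrite sym (ι-∧ (X v) (δ u)) | sym (ι-∧ (δ v) (X u)) =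
      ι-∧-∨ (U u) (A v u) (X v ∧ δ u) (δ v ∧ X u)
        (λ t → let v∈X , u≡y = xδ u t in subst (T ∘ U) (sym u≡y) (holds y∈U))
        (λ t → let v≡y , u∈X = δx u t in holds (S⊆U (X⊆S u∈X)))
        (λ q t → let v∈X , u≡y = xδ u t in x≁y v∈X (mem (subst (T ∘ A v) u≡y q)))
        (λ q t → let v≡y , u∈X = δx u t in x≁y u∈X (symmetric (mem (subst (λ z → T (A z u)) v≡y q))))
        (λ t t′ → let v∈X , _ = xδ u t ; v≡y , _ = δx u t′ in y∉X (subst (_∈ X) v≡y v∈X))
      where
      xδ : ∀ u → T (X v ∧ δ u) → v ∈ X × u ≡ y
      xδ u t = let p , q = Equivalence.to T-∧ t in mem p , ∈-setOf⁻ (Fin._≟ y) (mem q)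
      δx : ∀ u → T (δ v ∧ X u) → v ≡ y × u ∈ X
      δx u t = let p , q = Equivalence.to T-∧ t in ∈-setOf⁻ (Fin._≟ y) (mem p) , mem q

  deg-X : ∀ {x} → x ∈ X → deg A U x ≡ count S
  deg-X {x} x∈X = count-cong
    (λ w∈ → let w∈U , xw = ∈-∩⁻ U (A x) w∈ in X-closed x∈X w∈U xw)
    (λ w∈S → ∈-∩⁺ (S⊆U w∈S) (S-clique (X⊆S x∈X) w∈S))

  -- Every vertex of X gets closer to K, which pays for the growth at y.
  deviation⁺ : ∀ {K} → count S < K → deviation K A⁺ U ≤ deviation K A U
  deviation⁺ {K} |S|<K = +-cancelʳ-≤ (count X) _ _ (begin
    deviation K A⁺ U + count X
      ≡⟨ ∑-distrib-+ (λ v → ι (U v) * ∣ deg A⁺ U v - K ∣) _ ⟨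
    sum (λ v → ι (U v) * ∣ deg A⁺ U v - K ∣ + ι (X v))
      ≤⟨ sum-mono-≤ pointwise ⟩
    sum (λ v → ι (U v) * ∣ deg A U v - K ∣ + ι (δ v) * count X)
      ≡⟨ ∑-distrib-+ (λ v → ι (U v) * ∣ deg A U v - K ∣) _ ⟩
    deviation K A U + sum (λ v → ι (δ v) * count X)
      ≡⟨ cong (deviation K A U +_) (trans (sym (*-distribʳ-sum (count X) (ι ∘ δ)))
           (trans (cong (_* count X) (sum-≟ y)) (*-identityˡ _))) ⟩
    deviation K A U + count X ∎)
    where
    open ≤-Reasoning
    pointwise : ∀ v → ι (U v) * ∣ deg A⁺ U v - K ∣ + ι (X v) ≤ ι (U v) * ∣ deg A U v - K ∣ + ι (δ v) * count X
    pointwise v rewrite deg⁺ v =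
      closer (U v) (X v) (δ v)
        (λ t → holds (S⊆U (X⊆S (mem t)))) (λ t → subst (_< K) (sym (deg-X (mem t))) |S|<K)
        (λ t t′ → y∉X (subst (_∈ X) (∈-setOf⁻ (Fin._≟ y) (mem t′)) (mem t)))
      where
      closer : ∀ u x e {d c} → (T x → T u) → (T x → d < K) → (T x → T e → ⊥) →
        ι u * ∣ d + (ι x + ι e * c) - K ∣ + ι x ≤ ι u * ∣ d - K ∣ + ι e * c
      closer false true  _     f _ _ = ⊥-elim (f tt)
      closer false false _     _ _ _ = z≤n
      closer true  true  true  _ _ h = ⊥-elim (h tt tt)
      closer true  false false {d} _ _ _ rewrite +-identityʳ d = ≤-refl
      -- The vertex `y`: its term grows by at most the number `c` of its new neighbours.
      closer true  false true  {d} {c} _ _ _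
        rewrite +-identityʳ c | +-identityʳ ∣ d + c - K ∣ | +-identityʳ ∣ d - K ∣ = begin
          ∣ d + c - K ∣ + 0 ≡⟨ +-identityʳ _ ⟩
          ∣ d + c - K ∣ ≤⟨ ∣-∣-triangle (d + c) d K ⟩
          ∣ d + c - d ∣ + ∣ d - K ∣ ≡⟨ cong (_+ ∣ d - K ∣) (∣m+n-m∣≡n d c) ⟩
          c + ∣ d - K ∣ ≡⟨ +-comm c _ ⟩
          ∣ d - K ∣ + c ∎
      -- A vertex of `X`: since `d < K`, its one new neighbour lowers the term by exactly one.
      closer true  true  false {d} _ d<K _
        rewrite +-comm d 1 | m≤n⇒∣m-n∣≡n∸m (d<K tt) | m≤n⇒∣m-n∣≡n∸m (<⇒≤ (d<K tt))
        | +-identityʳ (K ∸ suc d) | +-identityʳ (K ∸ d) | +-identityʳ (K ∸ d) = ≤-reflexive (begin-equality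
          K ∸ suc d + 1 ≡⟨ +-comm (K ∸ suc d) 1 ⟩
          1 + (K ∸ suc d) ≡⟨ +-∸-assoc 1 (d<K tt) ⟨
          suc K ∸ suc d ∎)

  -- The drop is strict at `x`, which gains the neighbour `y`; had they been adjacent before,
  -- `X-closed` would put `y` into `S`.
  gaps⁺ : gaps A⁺ U < gaps A U
  gaps⁺ = sum-mono-< (λ v → *-monoʳ-≤ (ι (U v)) (count-mono-≤ shrink)) x
    (subst (λ b → ι b * count (U ∖ A⁺ x) < ι b * count (U ∖ A x)) (sym (T-ext {U x} (λ _ → tt) (λ _ → holds x∈U)))
      (subst₂ _<_ (sym (*-identityˡ _)) (sym (*-identityˡ _))
        (count-mono-< shrink (λ y∈ → proj₂ (∈-∖⁻ U (A⁺ x) y∈) (y-S (X⊆S x∈X)))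
          (∈-∖⁺ y∈U λ xy → y∉S (X-closed x∈X y∈U xy)))))
    where
    x∈U : x ∈ U
    x∈U = S⊆U (X⊆S x∈X)
    shrink : ∀ {v} → U ∖ A⁺ v ⊆ U ∖ A v
    shrink {v} w∈ = let w∈U , vw = ∈-∖⁻ U (A⁺ v) w∈ in ∈-∖⁺ w∈U (vw ∘ to⁺ ∘ inj₁)

-- Induction for the lower bound on the deviation.

gaps-⊆ : ∀ {R} → R ⊆ U → gaps A R ≤ gaps A U
gaps-⊆ {U = U} {A = A} {R} R⊆U = sum-mono-≤ λ v →
  *-mono-≤ (ι-mono (holds ∘ R⊆U {v} ∘ mem)) (count-mono-≤ λ w∈ →
    let w∈R , vw = ∈-∖⁻ R (A v) w∈ in ∈-∖⁺ (R⊆U w∈R) vw)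

deviation-clique : ∀ {K} → Clique A U → count U ≤ K → deviation K A U ≡ count U * (K ∸ count U)
deviation-clique {A = A} {U = U} {K} clique |U|≤K = begin
  deviation K A U                            ≡⟨ sum-cong-≗ (λ v → pointwise v (U v) refl) ⟩
  sum (λ v → ι (U v) * (K ∸ count U)) ≡⟨ *-distribʳ-sum (K ∸ count U) (ι ∘ U) ⟨
  count U * (K ∸ count U)                    ∎
  where
  open ≡-Reasoning
  pointwise : ∀ v b → U v ≡ b → ι b * ∣ deg A U v - K ∣ ≡ ι b * (K ∸ count U)
  pointwise v false _ = refl
  pointwise v true Uv = cong (1 *_) (trans
    (cong (∣_- K ∣) (count-cong (proj₁ ∘ ∈-∩⁻ U (A v))
      (λ w∈ → ∈-∩⁺ w∈ (clique (mem (subst T (sym Uv) tt)) w∈))))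
    (m≤n⇒∣m-n∣≡n∸m |U|≤K))

-- `w` stands for `K - z`. Deleting a clique lowers `count U` without raising `gaps`, and joining
-- `X` to `y` lowers `gaps` with `U` unchanged; hence the induction on their sum.
deviation-bound : ∀ {K} .{{_ : NonZero K}} → Acc _<_ (count U + gaps A U) → IsChordal A U →
  ∀ q {z w} → z + w ≡ K → count U ≡ q * K + z → z * w ≤ deviation K A U
deviation-bound {U = U} {A = A} {K} (acc smaller) ch q {z} {w} z+w≡K |U| = by-clique-or-leaf (clique-or-leaf ch)
  where
  open IsChordal ch
  open ≤-Reasoning
  remove : ∀ {S} → S ⊆ U → Clique A S → K ≤ count S → z * w ≤ deviation K A U
  remove {S} S⊆U clique K≤|S| = by-quotient q |U|
    where
    t = count S ∸ K
    |S|≡ : count S ≡ K + t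
    |S|≡ = sym (m+[n∸m]≡n K≤|S|)
    R = U ∖ S
    |R| : K + t + count R ≡ count U
    |R| = trans (cong (_+ count R) (sym |S|≡)) (count-∖ S⊆U)
    R⊆U : R ⊆ U
    R⊆U = proj₁ ∘ ∈-∖⁻ U S
    decrease : count R + gaps A R < count U + gaps A U
    decrease = +-mono-<-≤
      (subst (count R <_) |R| (m<n+m (count R) (≤-trans (>-nonZero⁻¹ K) (m≤m+n K t)))) (gaps-⊆ R⊆U)
    drop : deviation K A R + (K + t) * t ≤ deviation K A U
    drop = deviation-∖ K t A-sym S⊆U clique |S|≡
    by-quotient : ∀ q → count U ≡ q * K + z → z * w ≤ deviation K A U
    -- Here `z` equals `count U`, which is at least `K` because of `S`, so nothing is left for `w`.
    by-quotient zero |U| = subst (_≤ deviation K A U) (sym (trans (cong (z *_) w≡0) (*-zeroʳ z))) z≤n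
      where
      w≡0 : w ≡ 0
      w≡0 = n≤0⇒n≡0 (+-cancelˡ-≤ z w 0 (begin
        z + w ≡⟨ z+w≡K ⟩
        K ≤⟨ m≤m+n K (t + count R) ⟩
        K + (t + count R) ≡⟨ +-assoc K t _ ⟨
        K + t + count R ≡⟨ trans |R| |U| ⟩
        z ≡⟨ +-identityʳ z ⟨
        z + 0 ∎))
    by-quotient (suc q) |U| with t ≤? z
    -- For `t > z` the gain `(K + t) * t` from the deletion suffices, whatever remains.
    ... | no t≰z = begin
      z * w             ≤⟨ *-mono-≤ (<⇒≤ (≰⇒> t≰z)) (m+n≤o⇒n≤o z (≤-reflexive z+w≡K)) ⟩
      t * K             ≡⟨ *-comm t K ⟩
      K * t             ≤⟨ *-monoˡ-≤ t (m≤m+n K t) ⟩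
      (K + t) * t       ≤⟨ m+n≤o⇒n≤o _ drop ⟩
      deviation K A U   ∎
    -- There remain `q * K + (z - t)` vertices, so the induction hypothesis applies with `z - t` and
    -- `w + t`. Together with `(K + t) * t` it exceeds `z * w` by `2 * t * z`, the term inserted
    -- below.
    ... | yes t≤z = begin
      z * w                             ≡⟨ cong (_* w) z≡ ⟩
      (z′ + t) * w                      ≤⟨ m≤m+n _ (t * (z′ + z′ + t + t)) ⟩
      (z′ + t) * w + t * (z′ + z′ + t + t) ≡⟨ rearrange z′ t w ⟩
      z′ * (w + t) + ((z′ + t) + w + t) * t
        ≡⟨ cong (λ k → z′ * (w + t) + (k + t) * t) (trans (cong (_+ w) (sym z≡)) z+w≡K) ⟩
      z′ * (w + t) + (K + t) * t        ≤⟨ +-monoˡ-≤ _ (deviation-bound (smaller decrease) (IsChordal-⊆ R⊆U ch) q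
                                              z′+w′≡K |R|≡) ⟩
      deviation K A R + (K + t) * t     ≤⟨ drop ⟩
      deviation K A U                   ∎
      where
      z′ = z ∸ t
      z≡ : z ≡ z′ + t
      z≡ = sym (m∸n+n≡m t≤z)
      z′+w′≡K : z′ + (w + t) ≡ K
      z′+w′≡K = trans (shuffle z′ t w) (trans (cong (_+ w) (sym z≡)) z+w≡K)
        where
        shuffle : ∀ a b c → a + (c + b) ≡ a + b + c
        shuffle = solve-∀
      rearrange : ∀ a t w → (a + t) * w + t * (a + a + t + t) ≡ a * (w + t) + ((a + t) + w + t) * t
      rearrange = solve-∀
      |R|≡ : count R ≡ q * K + z′
      |R|≡ = +-cancelˡ-≡ (K + t) _ _ (begin-equality
        K + t + count R ≡⟨ trans |R| |U| ⟩
        K + q * K + z ≡⟨ cong (K + q * K +_) z≡ ⟩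
        K + q * K + (z′ + t) ≡⟨ shuffle K (q * K) z′ t ⟩
        K + t + (q * K + z′) ∎)
        where
        shuffle : ∀ a b c d → a + b + (c + d) ≡ a + d + (b + c)
        shuffle = solve-∀

  by-clique-or-leaf : Clique A U ⊎ Leaf A U → z * w ≤ deviation K A U
  by-clique-or-leaf (inj₁ clique) with K ≤? count U
  ... | yes K≤|U| = remove id clique K≤|U|
  -- With fewer than `K` vertices `q` must be zero, so `z` is `count U` and the bound is an
  -- equality.
  ... | no K≰|U| = ≤-reflexive (trans (cong₂ _*_ z≡ w≡) (sym (deviation-clique clique |U|≤K)))
    where
    |U|≤K : count U ≤ K
    |U|≤K = <⇒≤ (≰⇒> K≰|U|)
    quotient-zero : ∀ q → count U ≡ q * K + z → count U ≡ z
    quotient-zero zero    |U| = |U|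
    quotient-zero (suc q) |U| = contradiction
      (≤-trans (m≤m+n K (q * K + z)) (≤-reflexive (trans (sym (+-assoc K (q * K) z)) (sym |U|)))) K≰|U|
    z≡ : z ≡ count U
    z≡ = sym (quotient-zero q |U|)
    w≡ : w ≡ K ∸ count U
    w≡ = trans (sym (m+n∸m≡n z w)) (cong₂ _∸_ z+w≡K z≡)
  by-clique-or-leaf (inj₂ ℓ) with K ≤? count (Leaf.S ℓ)
  ... | yes K≤|S| = remove (Leaf.S⊆U ℓ) (Leaf.S-clique ℓ) K≤|S|
  ... | no K≰|S| = ≤-trans
    (deviation-bound (smaller (+-monoʳ-< (count U) gaps⁺)) chordal⁺ q z+w≡K |U|)
    (deviation⁺ (≰⇒> K≰|S|))
    where open Attach ch ℓ

-- Graphs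

length-filter-tabulate : ∀ {A : Set} {P : A → Set} (P? : ∀ a → Dec (P a)) {n} (f : Fin n → A) →
  length (filter P? (tabulate f)) ≡ count (does ∘ P? ∘ f)
length-filter-tabulate P? {zero}  f = refl
length-filter-tabulate P? {suc n} f with does (P? (f zero))
... | true  = cong suc (length-filter-tabulate P? (f ∘ suc))
... | false = length-filter-tabulate P? (f ∘ suc)

length-filter-map : ∀ {A B : Set} {P : B → Set} (P? : ∀ b → Dec (P b)) (f : A → B) xs →
  length (filter P? (map f xs)) ≡ length (filter (P? ∘ f) xs)
length-filter-map P? f [] = refl
length-filter-map P? f (x ∷ xs) with does (P? (f x))
... | true  = cong suc (length-filter-map P? f xs)
... | false = length-filter-map P? f xs

-- For `handshake`: turns the length of the edge list into a double sum.
length-filter-cartesianProduct : ∀ {A B : Set} {P : A × B → Set} (P? : ∀ p → Dec (P p)) {m} (f : Fin m → A) ys →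
  length (filter P? (cartesianProduct (tabulate f) ys)) ≡ sum (λ i → length (filter (P? ∘ (f i ,_)) ys))
length-filter-cartesianProduct P? {zero}  f ys = refl
length-filter-cartesianProduct P? {suc m} f ys = begin
  length (filter P? (map (f zero ,_) ys ++ rest))
    ≡⟨ cong length (filter-++ P? (map (f zero ,_) ys) rest) ⟩
  length (filter P? (map (f zero ,_) ys) ++ filter P? rest)
    ≡⟨ length-++ (filter P? (map (f zero ,_) ys)) ⟩
  length (filter P? (map (f zero ,_) ys)) + length (filter P? rest)
    ≡⟨ cong₂ _+_ (length-filter-map P? (f zero ,_) ys) (length-filter-cartesianProduct P? (f ∘ suc) ys) ⟩
  length (filter (P? ∘ (f zero ,_)) ys) + sum (λ i → length (filter (P? ∘ (f (suc i) ,_)) ys)) ∎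
  where
  open ≡-Reasoning
  rest = cartesianProduct (tabulate (f ∘ suc)) ys

module _ {n} (G : Graph n) where
  open Graph G renaming (sym to ~-sym)

  closedNbr? : ∀ u v → Dec (v ≡ u ⊎ u ~ v)
  closedNbr? u v = (v Fin.≟ u) ⊎-dec (u ~? v)

  closedNbr : Adjacency n
  closedNbr u = setOf (closedNbr? u)

  count-closedNbr : ∀ u → count (closedNbr u) ≡ suc (degree u)
  count-closedNbr u = begin
    count (closedNbr u)
      ≡⟨ sum-cong-≗ (λ v → disjoint (v Fin.≟ u) (u ~? v) λ { refl → irrefl refl }) ⟩
    sum (λ v → ι (does (v Fin.≟ u)) + ι (does (u ~? v)))
      ≡⟨ ∑-distrib-+ (λ v → ι (does (v Fin.≟ u))) _ ⟩
    sum (λ v → ι (does (v Fin.≟ u))) + count (does ∘ (u ~?_))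
      ≡⟨ cong₂ _+_ (sum-≟ u) (sym (length-filter-tabulate (u ~?_) id)) ⟩
    suc (degree u) ∎
    where
    open ≡-Reasoning
    disjoint : ∀ {P Q : Set} (P? : Dec P) (Q? : Dec Q) → (P → ¬ Q) →
      ι (does (P? ⊎-dec Q?)) ≡ ι (does P?) + ι (does Q?)
    disjoint (yes p) (yes q) f = contradiction q (f p)
    disjoint (yes p) (no _)  _ = refl
    disjoint (no _)  (yes _) _ = refl
    disjoint (no _)  (no _)  _ = refl

  -- Each adjacency is counted by exactly one of `up u v` and `up v u`; exchanging the order of
  -- summation turns the second half into the first.
  handshake : sum degree ≡ size + size
  handshake = begin
    sum degree
      ≡⟨ sum-cong-≗ (λ u → trans (length-filter-tabulate (u ~?_) id) (sum-cong-≗ (split u))) ⟩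
    sum (λ u → sum (λ v → up u v + up v u))
      ≡⟨ sum-cong-≗ (λ u → ∑-distrib-+ (up u) (λ v → up v u)) ⟩
    sum (λ u → sum (up u) + sum (λ v → up v u))
      ≡⟨ ∑-distrib-+ (sum ∘ up) _ ⟩
    sum (sum ∘ up) + sum (λ u → sum (λ v → up v u))
      ≡⟨ cong (sum (sum ∘ up) +_) (∑-comm (λ u v → up v u)) ⟩
    sum (sum ∘ up) + sum (sum ∘ up)
      ≡⟨ cong₂ _+_ size≡ size≡ ⟨
    size + size ∎
    where
    open ≡-Reasoning
    up? : (p : Fin n × Fin n) → Dec _
    up? (u , v) = (u Fin.<? v) ×-dec (u ~? v)
    up : Fin n → Fin n → ℕ
    up u v = ι (does (up? (u , v)))
    size≡ : size ≡ sum (sum ∘ up)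
    size≡ = trans (length-filter-cartesianProduct up? id (allFin n))
      (sum-cong-≗ (λ u → length-filter-tabulate (up? ∘ (u ,_)) id))
    split : ∀ u v → ι (does (u ~? v)) ≡ up u v + up v u
    split u v = by-cases (u ~? v) (v ~? u) (u Fin.<? v) (v Fin.<? u) (Fin.<-cmp u v)
      where
      by-cases : (e : Dec (u ~ v)) (e′ : Dec (v ~ u)) (lt : Dec (u Fin.< v)) (gt : Dec (v Fin.< u)) →
        Tri (u Fin.< v) (u ≡ v) (v Fin.< u) → ι (does e) ≡ ι (does (lt ×-dec e)) + ι (does (gt ×-dec e′))
      by-cases (yes uv) (no ¬vu) _ _ _ = contradiction (~-sym uv) ¬vu
      by-cases (no ¬uv) (yes vu) _ _ _ = contradiction (~-sym vu) ¬uv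
      by-cases (no _) (no _) (yes _) (yes _) _ = refl
      by-cases (no _) (no _) (yes _) (no _) _ = refl
      by-cases (no _) (no _) (no _) (yes _) _ = refl
      by-cases (no _) (no _) (no _) (no _) _ = refl
      by-cases (yes _) (yes _) (yes _) (no _) _ = refl
      by-cases (yes _) (yes _) (no _) (yes _) _ = refl
      by-cases (yes _) (yes _) (yes u<v) (yes v<u) _ = contradiction v<u (<-asym u<v)
      by-cases (yes _) (yes _) (no u≮v) (no _) (tri< u<v _ _) = contradiction u<v u≮v
      by-cases (yes uv) (yes _) (no _) (no _) (tri≈ _ u≡v _) = contradiction uv (irrefl u≡v)
      by-cases (yes _) (yes _) (no _) (no v≮u) (tri> _ _ v<u) = contradiction v<u v≮u

  -- Chordless cycles and detours.

  Away : Fin n → Fin n → Set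
  Away v u = ¬ v ~ u × v ≢ u

  -- A shortest counterexample w 0, …, w L would close up with v to a chordless cycle.
  no-hole : Chordal G → ∀ L → Acc _<_ L → ∀ v (w : ℕ → Fin n) → v ~ w 0 → v ~ w L →
    (∀ i → 0 < i → i < L → Away v (w i)) → (∀ i → i < L → w i ~ w (suc i)) → w 0 ≢ w L → w 0 ~ w L
  no-hole chordal zero _ v w _ _ _ _ w0≢wL = contradiction refl w0≢wL
  no-hole chordal (suc zero) _ v w _ _ _ step _ = step 0 ≤-refl
  no-hole chordal L@(suc (suc _)) (acc shorter) v w vw0 vwL away step w0≢wL =
    decidable-stable (w 0 ~? w L) absurd
    where
    -- An edge from `w i` to `w j` allows the `e` vertices between them to be cut out: `w′` follows
    -- `w` up to index `i` and then `w` shifted by `e`. This shorter sequence has the same ends.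
    shortcut : ∀ i j → suc i < j → j ≤ L → w i ~ w j → w 0 ~ w L
    shortcut i j i<j j≤L wij = subst₂ _~_ w′0 w′L
      (no-hole chordal L′ (shorter L′<L) v w′ (subst (v ~_) (sym w′0) vw0) (subst (v ~_) (sym w′L) vwL)
        away′ step′ (λ eq → w0≢wL (trans (sym w′0) (trans eq w′L))))
      where
      e = j ∸ suc i
      L′ = L ∸ e
      j≡ : suc i + e ≡ j
      j≡ = m+[n∸m]≡n (<⇒≤ i<j)
      e≤L : e ≤ L
      e≤L = ≤-trans (m∸n≤m j (suc i)) j≤L
      L≡ : L′ + e ≡ L
      L≡ = m∸n+n≡m e≤L
      i<L′ : i < L′
      i<L′ = +-cancelʳ-≤ e (suc i) L′ (subst₂ _≤_ (sym j≡) (sym L≡) j≤L)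
      L′<L : L′ < L
      L′<L = ∸-monoʳ-< (m<n⇒0<n∸m i<j) e≤L
      w′ : ℕ → Fin n
      w′ t = if does (t ≤? i) then w t else w (t + e)
      w′-≤ : ∀ {t} → t ≤ i → w′ t ≡ w t
      w′-≤ {t} t≤i rewrite dec-true (t ≤? i) t≤i = refl
      w′-> : ∀ {t} → i < t → w′ t ≡ w (t + e)
      w′-> {t} i<t rewrite dec-false (t ≤? i) (<⇒≱ i<t) = refl
      w′0 : w′ 0 ≡ w 0
      w′0 = w′-≤ z≤n
      w′L : w′ L′ ≡ w L
      w′L = trans (w′-> i<L′) (cong w L≡)
      <L : ∀ {t} → t < L′ → t + e < L
      <L {t} t<L′ = subst (t + e <_) L≡ (+-monoˡ-< e t<L′)
      away′ : ∀ t → 0 < t → t < L′ → Away v (w′ t)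
      away′ t 0<t t<L′ with t ≤? i
      ... | yes t≤i = subst (Away v) (sym (w′-≤ t≤i)) (away t 0<t (<-trans t<L′ L′<L))
      ... | no t≰i = subst (Away v) (sym (w′-> (≰⇒> t≰i))) (away (t + e) (≤-trans 0<t (m≤m+n t e)) (<L t<L′))
      step′ : ∀ t → t < L′ → w′ t ~ w′ (suc t)
      step′ t t<L′ with <-cmp t i
      ... | tri< t<i _ _ = subst₂ _~_ (sym (w′-≤ (<⇒≤ t<i))) (sym (w′-≤ t<i)) (step t (<-trans t<L′ L′<L))
      ... | tri≈ _ refl _ = subst₂ _~_ (sym (w′-≤ ≤-refl)) (sym (trans (w′-> ≤-refl) (cong w j≡))) wij
      ... | tri> _ _ i<t = subst₂ _~_ (sym (w′-> i<t)) (sym (w′-> (m<n⇒m<1+n i<t))) (step (t + e) (<L t<L′))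

    module _ (w0≁wL : ¬ w 0 ~ w L) where
      -- If `w i` equals `w j` with `j < L`, it is adjacent to `w (suc j)`, a shortcut. If `j` is
      -- `L`, then `i > 0` and `w i` would be adjacent to `v`.
      distinct : ∀ i j → i < j → j ≤ L → w i ≢ w j
      distinct i j i<j j≤L wi≡wj with m≤n⇒m<n∨m≡n j≤L
      ... | inj₁ j<L = w0≁wL (shortcut i (suc j) (s≤s i<j) j<L (subst (_~ w (suc j)) (sym wi≡wj) (step j j<L)))
      distinct zero    j i<j j≤L wi≡wj | inj₂ refl = w0≢wL wi≡wj
      distinct (suc i) j i<j j≤L wi≡wj | inj₂ refl =
        proj₁ (away (suc i) (s≤s z≤n) i<j) (subst (v ~_) (sym wi≡wj) vwL)

      v≢w : ∀ i → i ≤ L → v ≢ w i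
      v≢w zero _ v≡w = irrefl v≡w vw0
      v≢w i@(suc _) i≤L v≡w with m≤n⇒m<n∨m≡n i≤L
      ... | inj₁ i<L = proj₂ (away i (s≤s z≤n) i<L) v≡w
      ... | inj₂ refl = irrefl v≡w vwL

      -- `v` comes first, then `w 0` to `w L`; the length exceeds three because `L` is at least two.
      vertex : Fin (2 + L) → Fin n
      vertex zero    = v
      vertex (suc i) = w (toℕ i)

      ≤L : (i : Fin (suc L)) → toℕ i ≤ L
      ≤L i = s≤s⁻¹ (Fin.toℕ<n i)

      injective : ∀ {i j} → vertex i ≡ vertex j → i ≡ j
      injective {zero}  {zero}  _  = refl
      injective {zero}  {suc j} eq = contradiction eq (v≢w (toℕ j) (≤L j))
      injective {suc i} {zero}  eq = contradiction (sym eq) (v≢w (toℕ i) (≤L i))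
      injective {suc i} {suc j} eq with <-cmp (toℕ i) (toℕ j)
      ... | tri< i<j _ _ = contradiction eq (distinct _ _ i<j (≤L j))
      ... | tri≈ _ i≡j _ = cong suc (Fin.toℕ-injective i≡j)
      ... | tri> _ _ j<i = contradiction (sym eq) (distinct _ _ j<i (≤L i))

      adjacent : ∀ {i j} → Next i j → vertex i ~ vertex j
      adjacent {zero}  {suc j} (inj₁ eq) = subst (λ t → v ~ w t) (sym (suc-injective eq)) vw0
      adjacent {suc i} {suc j} (inj₁ eq) = subst (λ t → w (toℕ i) ~ w t) (sym (suc-injective eq))
        (step (toℕ i) (subst (_≤ L) (suc-injective eq) (≤L j)))
      adjacent {suc i} {zero}  (inj₂ (eq , _)) =
        subst (λ t → w t ~ v) (sym (suc-injective (suc-injective eq))) (~-sym vwL)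

      cycle : Cycle G (2 + L)
      cycle = record
        { 3≤length = s≤s (s≤s (s≤s z≤n))
        ; vertex = vertex
        ; injective = injective
        ; adjacent = adjacent
        }

      open Cycle cycle using (IsEdge)

      edge-swap : ∀ {a b} → IsEdge a b → IsEdge b a
      edge-swap (i , j , nx , e) = i , j , nx , Sum.swap e

      -- The only neighbours of `v` among these `w i` are the two ends, and both edges belong to the
      -- cycle.
      spoke : ∀ (i : Fin (suc L)) → v ~ w (toℕ i) → IsEdge v (w (toℕ i))
      spoke zero    _ = zero , suc zero , inj₁ refl , inj₁ (refl , refl)
      spoke i@(suc _) vw with m≤n⇒m<n∨m≡n (≤L i)
      ... | inj₁ i<L = contradiction vw (proj₁ (away _ (s≤s z≤n) i<L))
      ... | inj₂ i≡L = suc i , zero , inj₂ (cong 2+ i≡L , refl) , inj₂ (refl , refl)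

      rung : ∀ (i j : Fin (suc L)) → toℕ i < toℕ j → w (toℕ i) ~ w (toℕ j) → IsEdge (w (toℕ i)) (w (toℕ j))
      rung i j i<j wij with m≤n⇒m<n∨m≡n i<j
      ... | inj₁ 1+i<j = contradiction (shortcut _ _ 1+i<j (≤L j) wij) w0≁wL
      ... | inj₂ 1+i≡j = suc i , suc j , inj₁ (cong suc (sym 1+i≡j)) , inj₁ (refl , refl)

      chordless : ∀ i j → vertex i ~ vertex j → IsEdge (vertex i) (vertex j)
      chordless zero    zero    e = contradiction e (irrefl refl)
      chordless zero    (suc j) e = spoke j e
      chordless (suc i) zero    e = edge-swap (spoke i (~-sym e))
      chordless (suc i) (suc j) e with <-cmp (toℕ i) (toℕ j)
      ... | tri< i<j _ _ = rung i j i<j e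
      ... | tri≈ _ i≡j _ = contradiction e (irrefl (cong w i≡j))
      ... | tri> _ _ j<i = edge-swap (rung j i j<i (~-sym e))

      absurd : ⊥
      absurd with chordal cycle (s≤s (s≤s (s≤s (s≤s z≤n))))
      ... | _ , _ , ab , ¬edge , (i , refl) , (j , refl) = ¬edge (chordless i j ab)

  -- The last entry `y` need not lie in `Q`, and values after index `suc L` are arbitrary. Functions
  -- on ℕ let `no-hole` cut out a stretch by shifting indices.
  Sequence : VertexSet n → Fin n → Fin n → Set
  Sequence Q c y = ∃₂ λ (L : ℕ) (w : ℕ → Fin n) →
    w 0 ≡ c × w (suc L) ≡ y × (∀ i → i ≤ L → w i ∈ Q) × (∀ i → i ≤ L → w i ~ w (suc i))

  -- The steps of a Walk may be stationary, those of a Sequence are not.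
  walk-sequence : ∀ {Q c d y} → c ∈ Q → Walk closedNbr Q c d → d ~ y → Sequence Q c y
  walk-sequence {c = c} {y = y} c∈Q ε dy =
    0 , (λ { zero → c ; (suc _) → y }) , refl , refl , (λ { zero _ → c∈Q }) , (λ { zero _ → dy })
  walk-sequence {c = c} c∈Q (link _ e∈Q ce ◅ walk) dy
    with ∈-setOf⁻ (closedNbr? c) ce | walk-sequence e∈Q walk dy
  ... | inj₁ refl | seq = seq
  ... | inj₂ c~e | L , w , refl , wL , w∈Q , step =
    suc L , (λ { zero → c ; (suc i) → w i }) , refl , wL ,
    (λ { zero _ → c∈Q ; (suc i) (s≤s i≤L) → w∈Q i i≤L }) ,
    (λ { zero _ → c~e ; (suc i) (s≤s i≤L) → step i i≤L })

  closedNbr-chordal : Chordal G → ∀ U → IsChordal closedNbr U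
  closedNbr-chordal chordal U = record
    { A-sym = λ u v → T-ext (holds ∘ symmetric ∘ mem) (holds ∘ symmetric ∘ mem)
    ; A-refl = λ v → ∈-setOf⁺ (closedNbr? v) (inj₁ refl)
    ; detour = λ _ _ _ → detour
    }
    where
    symmetric : ∀ {u v} → v ∈ closedNbr u → u ∈ closedNbr v
    symmetric {u} {v} = ∈-setOf⁺ (closedNbr? v) ∘ Sum.map sym ~-sym ∘ ∈-setOf⁻ (closedNbr? u)
    proper : ∀ {u v} → v ∈ closedNbr u → v ≢ u → u ~ v
    proper {u} vu v≢u = [ (λ v≡u → contradiction v≡u v≢u) , id ]′ (∈-setOf⁻ (closedNbr? u) vu)
    end∈ : ∀ {Q c d} → c ∈ Q → Walk closedNbr Q c d → d ∈ Q
    end∈ c∈ ε = c∈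
    end∈ _ (link _ e∈ _ ◅ walk) = end∈ e∈ walk
    detour : ∀ {v x y c d} → x ∈ closedNbr v → y ∈ closedNbr v → c ∈ U ∖ closedNbr v →
      Walk closedNbr (U ∖ closedNbr v) c d → c ∈ closedNbr x → y ∈ closedNbr d → y ∈ closedNbr x
    detour {v} {x} {y} {c} {d} vx vy c∈ walk xc dy with y Fin.≟ x
    ... | yes y≡x = ∈-setOf⁺ (closedNbr? x) (inj₁ y≡x)
    ... | no y≢x = ∈-setOf⁺ (closedNbr? x) (inj₂ (x~y (walk-sequence c∈ walk d~y)))
      where
      c∉ = proj₂ (∈-∖⁻ U (closedNbr v) c∈)
      d∉ = proj₂ (∈-∖⁻ U (closedNbr v) (end∈ c∈ walk))
      -- An equality in any of these four pairs would put `c` or `d` into N[v], so closed adjacency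
      -- is proper adjacency.
      v~x : v ~ x
      v~x = proper vx λ { refl → c∉ xc }
      v~y : v ~ y
      v~y = proper vy λ { refl → d∉ (symmetric dy) }
      x~c : x ~ c
      x~c = proper xc λ { refl → c∉ vx }
      d~y : d ~ y
      d~y = proper dy λ { refl → d∉ vy }
      x~y : Sequence (U ∖ closedNbr v) c y → x ~ y
      x~y (L , w , w0≡c , wL≡y , w∈ , step) = subst (x ~_) wL≡y
        -- With `x` put in front at index 0, the walk occupies 1 to `L + 1` and `y` has index
        -- `L + 2`.
        (no-hole chordal (2 + L) (<-wellFounded _) v (λ { zero → x ; (suc i) → w i }) v~x
          (subst (v ~_) (sym wL≡y) v~y)
          (λ { (suc i) _ (s≤s (s≤s i≤L)) → away (proj₂ (∈-∖⁻ U (closedNbr v) (w∈ i i≤L))) })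
          (λ { zero _ → subst (x ~_) (sym w0≡c) x~c ; (suc i) (s≤s (s≤s i≤L)) → step i i≤L })
          (λ x≡w → y≢x (sym (trans x≡w wL≡y))))
        where
        away : ∀ {u} → u ∉ closedNbr v → Away v u
        away u∉ = u∉ ∘ ∈-setOf⁺ (closedNbr? v) ∘ inj₂ , λ { refl → u∉ (∈-setOf⁺ (closedNbr? v) (inj₁ refl)) }

-- The lower bound on the size.

everything : ∀ {n} → VertexSet n
everything _ = true

-- Stated for twice the size to avoid division. Adding `n` on both sides turns `n * k` into
-- `n * suc k` and degrees into sizes of closed neighbourhoods; as all degrees are at least `k`, the
-- absolute values open up.
chordal-size : ∀ {n} (G : Graph n) k → Chordal G → (∀ v → k ≤ Graph.degree G v) → ∀ q {r w} →
  r + w ≡ suc k → n ≡ q * suc k + r → n * k + r * w ≤ Graph.size G + Graph.size G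
chordal-size {n} G k chordal k≤degree q {r} {w} r+w≡K n≡ = +-cancelˡ-≤ n _ _ (begin
  n + (n * k + r * w)           ≡⟨ +-assoc n (n * k) _ ⟨
  n + n * k + r * w             ≤⟨ +-monoʳ-≤ (n + n * k) (deviation-bound (<-wellFounded _)
                                     (closedNbr-chordal G chordal everything) q r+w≡K
                                     (trans (trans (sum-const n 1) (*-identityʳ n)) n≡)) ⟩
  n + n * k + sum excess        ≡⟨ cong (_+ sum excess) (trans (sym (*-suc n k)) (sym (sum-const n (suc k)))) ⟩
  sum {n} (const (suc k)) + sum excess  ≡⟨ ∑-distrib-+ {n} (const (suc k)) excess ⟨
  sum (λ v → suc k + excess v)  ≡⟨ sum-cong-≗ pointwise ⟩
  sum (λ v → 1 + degree v)      ≡⟨ ∑-distrib-+ {n} (const 1) degree ⟩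
  sum {n} (const 1) + sum degree ≡⟨ cong₂ _+_ (trans (sum-const n 1) (*-identityʳ n)) (handshake G) ⟩
  n + (size + size)             ∎)
  where
  open ≤-Reasoning
  open Graph G using (degree; size)
  excess : Fin n → ℕ
  excess v = 1 * ∣ deg (closedNbr G) everything v - suc k ∣
  pointwise : ∀ v → suc k + excess v ≡ 1 + degree v
  pointwise v rewrite count-closedNbr G v | *-identityˡ ∣ degree v - k ∣ | m≤n⇒∣n-m∣≡n∸m (k≤degree v) =
    cong suc (m+[n∸m]≡n (k≤degree v))

-- The extremal graph

below : ℕ → VertexSet n
below b v = does (toℕ v <? b)

∈-below⁺ : ∀ {b} {v : Fin n} → toℕ v < b → v ∈ below b
∈-below⁺ {b = b} = ∈-setOf⁺ (λ v → toℕ v <? b)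

∈-below⁻ : ∀ b {v : Fin n} → v ∈ below b → toℕ v < b
∈-below⁻ b = ∈-setOf⁻ (λ v → toℕ v <? b)

count-below : ∀ {b} → b ≤ n → count {n} (below b) ≡ b
count-below {n}     z≤n       = sum-replicate-zero n
count-below {suc n} (s≤s b≤n) = cong suc (count-below b≤n)

-- All closed neighbourhoods in the extremal graph are intervals of indices, so this gives its
-- degrees.
count-interval : {S : VertexSet n} → ∀ a b → a ≤ b → b ≤ n →
  (∀ {v} → v ∈ S → a ≤ toℕ v × toℕ v < b) → (∀ {v} → a ≤ toℕ v → toℕ v < b → v ∈ S) →
  a + count S ≡ b
count-interval {n} {S} a b a≤b b≤n S⊆ ⊆S = begin
  a + count S                          ≡⟨ cong₂ _+_ (sym (count-below (≤-trans a≤b b≤n))) (count-cong to from) ⟩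
  count {n} (below a) + count {n} (below b ∖ below a)
    ≡⟨ count-∖ {n} {below a} {below b} (λ v∈ → ∈-below⁺ (≤-trans (∈-below⁻ a v∈) a≤b)) ⟩
  count {n} (below b)                  ≡⟨ count-below b≤n ⟩
  b                                    ∎
  where
  open ≡-Reasoning
  to : S ⊆ below b ∖ below a
  to v∈S = let a≤v , v<b = S⊆ v∈S in ∈-∖⁺ (∈-below⁺ v<b) (λ v∈ → <⇒≱ (∈-below⁻ a v∈) a≤v)
  from : below b ∖ below a ⊆ S
  from v∈ = let v∈b , v∉a = ∈-∖⁻ (below b) (below a) v∈ in
    ⊆S (≮⇒≥ (v∉a ∘ ∈-below⁺)) (∈-below⁻ b v∈b)

-- Cycles and elimination orderings.

argmin : ∀ {m} (f : Fin (suc m) → ℕ) → ∃ λ i → ∀ j → f i ≤ f j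
argmin {zero}  f = zero , λ { zero → ≤-refl }
argmin {suc m} f with argmin (f ∘ suc)
... | i , f-min with f zero ≤? f (suc i)
... | yes f0≤ = zero , λ { zero → ≤-refl ; (suc j) → ≤-trans f0≤ (f-min j) }
... | no f0≰ = suc i , λ { zero → <⇒≤ (≰⇒> f0≰) ; (suc j) → f-min j }

next : ∀ {m} (i : Fin (suc m)) → ∃ (Next i)
next {m} i with m≤n⇒m<n∨m≡n (s≤s⁻¹ (Fin.toℕ<n i))
... | inj₁ i<m = Fin.fromℕ< (s≤s i<m) , inj₁ (Fin.toℕ-fromℕ< (s≤s i<m))
... | inj₂ i≡m = zero , inj₂ (cong ℕ.suc i≡m , refl)

previous : ∀ {m} (i : Fin (suc m)) → ∃ λ h → Next h i
previous {m} zero = Fin.fromℕ m , inj₂ (cong ℕ.suc (Fin.toℕ-fromℕ m) , refl)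
previous (suc i) = Fin.inject₁ i , inj₁ (cong ℕ.suc (sym (Fin.toℕ-inject₁ i)))

-- `Next` on the underlying numbers, where matching on the equations can unify the indices.
CyclicSuc : ℕ → ℕ → ℕ → Set
CyclicSuc m i j = j ≡ suc i ⊎ (suc i ≡ m × j ≡ 0)

cyclic-no-loop : ∀ {m i j} → 3 < m → CyclicSuc m i j → i ≢ j
cyclic-no-loop (s≤s ()) (inj₂ (refl , refl)) refl

cyclic-unique : ∀ {m h i j} → i < m → j < m → CyclicSuc m h i → CyclicSuc m h j → i ≡ j
cyclic-unique _   _   (inj₁ refl) (inj₁ refl) = refl
cyclic-unique i<m _   (inj₁ refl) (inj₂ (refl , _)) = contradiction i<m (<-irrefl refl)
cyclic-unique _   j<m (inj₂ (refl , _)) (inj₁ refl) = contradiction j<m (<-irrefl refl)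
cyclic-unique _   _   (inj₂ (_ , refl)) (inj₂ (_ , refl)) = refl

cyclic-no-2-cycle : ∀ {m h i} → 3 < m → CyclicSuc m h i → ¬ CyclicSuc m i h
cyclic-no-2-cycle _ (inj₁ refl) (inj₁ ())
cyclic-no-2-cycle (s≤s (s≤s ())) (inj₁ refl) (inj₂ (refl , refl))
cyclic-no-2-cycle (s≤s (s≤s ())) (inj₂ (refl , refl)) (inj₁ refl)

cyclic-no-3-cycle : ∀ {m h i j} → 3 < m → CyclicSuc m h i → CyclicSuc m i j → ¬ CyclicSuc m j h
cyclic-no-3-cycle _ (inj₁ refl) (inj₁ refl) (inj₁ ())
cyclic-no-3-cycle (s≤s (s≤s (s≤s ()))) (inj₁ refl) (inj₁ refl) (inj₂ (refl , refl))
cyclic-no-3-cycle (s≤s (s≤s (s≤s ()))) (inj₁ refl) (inj₂ (refl , refl)) (inj₁ refl)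
cyclic-no-3-cycle _ (inj₁ refl) (inj₂ (refl , refl)) (inj₂ (() , _))
cyclic-no-3-cycle (s≤s (s≤s (s≤s ()))) (inj₂ (refl , refl)) (inj₁ refl) (inj₁ refl)

-- The hypothesis says that the order of the indices is a perfect elimination ordering. The two
-- neighbours of the least vertex of a cycle are then adjacent, and this edge is a chord.
chordal-by-elimination : (G : Graph n) →
  (∀ {x a b} → toℕ x ≤ toℕ a → toℕ x ≤ toℕ b → Graph._~_ G x a → Graph._~_ G x b → a ≢ b → Graph._~_ G a b) →
  Chordal G
chordal-by-elimination G simplicial {suc m} C 3<m =
  vertex h , vertex j , simplicial (i-min h) (i-min j) (~-sym (adjacent h→i)) (adjacent i→j) a≢b , ¬edge ,
  (h , refl) , (j , refl)
  where
  open Graph G renaming (sym to ~-sym)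
  open Cycle C
  i = proj₁ (argmin (toℕ ∘ vertex))
  i-min = proj₂ (argmin (toℕ ∘ vertex))
  h = proj₁ (previous i)
  h→i = proj₂ (previous i)
  j = proj₁ (next i)
  i→j = proj₂ (next i)
  a≢b : vertex h ≢ vertex j
  a≢b eq = cyclic-no-2-cycle 3<m i→j (subst (λ z → Next z i) (injective eq) h→i)
  -- A cycle edge from `h` to `j` would make `i` and `j` the same successor of `h`; one from `j` to
  -- `h` would close a triangle.
  ¬edge : ¬ IsEdge (vertex h) (vertex j)
  ¬edge (h′ , j′ , h→j , inj₁ (h≡ , j≡)) with injective h≡ | injective j≡
  ... | refl | refl = cyclic-no-loop 3<m i→j (cyclic-unique (Fin.toℕ<n i) (Fin.toℕ<n j) h→i h→j)
  ¬edge (j′ , h′ , j→h , inj₂ (j≡ , h≡)) with injective h≡ | injective j≡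
  ... | refl | refl = cyclic-no-3-cycle 3<m h→i i→j j→h

n/d≡q⇒q*d≤n : ∀ {d q} n .{{_ : NonZero d}} → n / d ≡ q → q * d ≤ n
n/d≡q⇒q*d≤n n refl = m/n*n≤m n _

n/d≡q⇒n<[1+q]*d : ∀ {d q} n .{{_ : NonZero d}} → n / d ≡ q → n < suc q * d
n/d≡q⇒n<[1+q]*d {d} n refl =
  subst (_< d + n / d * d) (sym (m≡m%n+[m/n]*n n d)) (+-monoˡ-< (n / d * d) (m%n<n n d))

q*d≤n<[1+q]*d⇒n/d≡q : ∀ {d q} n .{{_ : NonZero d}} → q * d ≤ n → n < suc q * d → n / d ≡ q
q*d≤n<[1+q]*d⇒n/d≡q {d} {q} n lower upper = ≤-antisym
  (s≤s⁻¹ (m<n*o⇒m/o<n upper))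
  (subst (_≤ n / d) (m*n/n≡m q d) (/-monoˡ-≤ d lower))

-- The blocks of K consecutive vertices are cliques, and so are the last K vertices; they meet the
-- last complete block in K - r vertices.
module Extremal (p k r : ℕ) (r≤k : r ≤ k) where
  K = suc k
  order = suc p * K + r
  base = p * K + r

  -- The `r` vertices after the complete blocks lie beyond `base`, so sharing a quotient gives them
  -- no further neighbours.
  Near : Fin order → Fin order → Set
  Near u v = toℕ u / K ≡ toℕ v / K ⊎ (base ≤ toℕ u × base ≤ toℕ v)

  near? : ∀ u v → Dec (Near u v)
  near? u v = (toℕ u / K ≟ toℕ v / K) ⊎-dec ((base ≤? toℕ u) ×-dec (base ≤? toℕ v))

  G : Graph order
  G = record
    { _~_    = λ u v → u ≢ v × Near u v
    ; _~?_   = λ u v → ¬? (u Fin.≟ v) ×-dec near? u v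
    ; sym    = λ (u≢v , near) → u≢v ∘ sym , Sum.map sym Product.swap near
    ; irrefl = λ u≡v (u≢v , _) → u≢v u≡v
    }

  open Graph G using (degree; size)

  G-chordal : Chordal G
  G-chordal = chordal-by-elimination G λ x≤a x≤b xa xb a≢b → a≢b , near x≤a x≤b (proj₂ xa) (proj₂ xb)
    where
    near : ∀ {x a b} → toℕ x ≤ toℕ a → toℕ x ≤ toℕ b → Near x a → Near x b → Near a b
    near _ _ (inj₁ xa) (inj₁ xb) = inj₁ (trans (sym xa) xb)
    -- As `x` is the least of the three, `base ≤ x` puts `a` and `b` among the last `K` vertices
    -- too.
    near x≤a x≤b (inj₂ (base≤x , _)) _ = inj₂ (≤-trans base≤x x≤a , ≤-trans base≤x x≤b)
    near x≤a x≤b _ (inj₂ (base≤x , _)) = inj₂ (≤-trans base≤x x≤a , ≤-trans base≤x x≤b)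

  ∈-closedNbr⁺ : ∀ {u v} → Near u v → v ∈ closedNbr G u
  ∈-closedNbr⁺ {u} {v} near = ∈-setOf⁺ (closedNbr? G u) (by-cases (v Fin.≟ u))
    where
    by-cases : Dec (v ≡ u) → v ≡ u ⊎ u ≢ v × Near u v
    by-cases (yes v≡u) = inj₁ v≡u
    by-cases (no v≢u)  = inj₂ (v≢u ∘ sym , near)

  ∈-closedNbr⁻ : ∀ {u v} → v ∈ closedNbr G u → Near u v
  ∈-closedNbr⁻ {u} v∈ with ∈-setOf⁻ (closedNbr? G u) v∈
  ... | inj₁ refl = inj₁ refl
  ... | inj₂ (_ , near) = near

  -- The `K - r` vertices common to the last two cliques: their degree is `k + r`, that of all
  -- others is `k`.
  middle : VertexSet order
  middle = below (suc p * K) ∖ below base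

  base≤ : base ≤ suc p * K
  base≤ = subst (_≤ K + p * K) (+-comm r (p * K)) (+-monoˡ-≤ (p * K) (m≤n⇒m≤1+n r≤k))

  order≡ : base + K ≡ order
  order≡ = shuffle (p * K) r K
    where
    shuffle : ∀ a b c → a + b + c ≡ c + a + b
    shuffle = solve-∀

  count-low : ∀ u → toℕ u < base → count (closedNbr G u) ≡ K
  count-low u u<base = +-cancelˡ-≡ (b * K) _ _ (trans
    (count-interval (b * K) (suc b * K) (m≤n+m (b * K) K)
      (≤-trans (*-monoˡ-≤ K b<1+p) (m≤m+n (suc p * K) r))
      (λ {v} v∈ → [ (λ same → n/d≡q⇒q*d≤n (toℕ v) (sym same) , n/d≡q⇒n<[1+q]*d (toℕ v) (sym same))
              , (λ (base≤u , _) → contradiction base≤u (<⇒≱ u<base)) ]′ (∈-closedNbr⁻ v∈))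
      (λ {v} lower upper → ∈-closedNbr⁺ (inj₁ (sym (q*d≤n<[1+q]*d⇒n/d≡q (toℕ v) lower upper)))))
    (+-comm K (b * K)))
    where
    b = toℕ u / K
    -- The block of `u` is complete, since it starts before `base`, which does not exceed
    -- `suc p * K`.
    b<1+p : b < suc p
    b<1+p = m<n*o⇒m/o<n (≤-trans u<base base≤)

  count-middle : ∀ u → base ≤ toℕ u → toℕ u < suc p * K → count (closedNbr G u) ≡ K + r
  count-middle u base≤u u< = +-cancelˡ-≡ (p * K) _ _ (trans
    (count-interval (p * K) order (≤-trans (m≤n+m (p * K) K) (m≤m+n _ r)) ≤-refl
      (λ {v} v∈ → [ (λ same → n/d≡q⇒q*d≤n (toℕ v) (trans (sym same) u/K≡p))
                  , (λ (_ , base≤v) → ≤-trans (m≤m+n (p * K) r) base≤v) ]′ (∈-closedNbr⁻ v∈) , Fin.toℕ<n v)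
      (λ {v} lower _ → ∈-closedNbr⁺ (above v lower)))
    (shuffle K (p * K) r))
    where
    shuffle : ∀ a b c → a + b + c ≡ b + (a + c)
    shuffle = solve-∀
    u/K≡p : toℕ u / K ≡ p
    u/K≡p = q*d≤n<[1+q]*d⇒n/d≡q (toℕ u) (≤-trans (m≤m+n (p * K) r) base≤u) u<
    above : ∀ v → p * K ≤ toℕ v → Near u v
    above v lower with toℕ v <? suc p * K
    ... | yes v< = inj₁ (trans u/K≡p (sym (q*d≤n<[1+q]*d⇒n/d≡q (toℕ v) lower v<)))
    ... | no v≮ = inj₂ (base≤u , ≤-trans base≤ (≮⇒≥ v≮))

  count-high : ∀ u → suc p * K ≤ toℕ u → count (closedNbr G u) ≡ K
  count-high u ≤u = +-cancelˡ-≡ base _ _ (trans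
    (count-interval base order (subst (base ≤_) order≡ (m≤m+n base K)) ≤-refl
      (λ {v} v∈ → [ (λ same → ≤-trans base≤ (≤-trans (*-monoˡ-≤ K (1+p≤ v same)) (m/n*n≤m (toℕ v) K)))
                  , proj₂ ]′ (∈-closedNbr⁻ v∈) , Fin.toℕ<n v)
      (λ lower _ → ∈-closedNbr⁺ (inj₂ (≤-trans base≤ ≤u , lower))))
    (sym order≡))
    where
    1+p≤ : ∀ v → toℕ u / K ≡ toℕ v / K → suc p ≤ toℕ v / K
    1+p≤ v same = subst₂ _≤_ (m*n/n≡m (suc p) K) same (/-monoˡ-≤ K ≤u)

  ∉-ι : ∀ (S : VertexSet order) {v} → v ∉ S → ι (S v) ≡ 0
  ∉-ι S {v} v∉S = cong ι (T-ext {S v} {false} (v∉S ∘ mem) ⊥-elim)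

  ∈-ι : ∀ (S : VertexSet order) {v} → v ∈ S → ι (S v) ≡ 1
  ∈-ι S {v} v∈S = cong ι (T-ext {S v} {true} (λ _ → tt) (λ _ → holds v∈S))

  count-nbr : ∀ u → count (closedNbr G u) ≡ K + ι (middle u) * r
  count-nbr u with toℕ u <? base | toℕ u <? suc p * K
  ... | yes u<base | _ = trans (count-low u u<base) (sym (trans (cong (λ i → K + i * r)
          (∉-ι middle (λ u∈ → proj₂ (∈-∖⁻ (below (suc p * K)) (below base) u∈) (∈-below⁺ u<base)))) (+-identityʳ K)))
  ... | no u≮base | yes u< = trans (count-middle u (≮⇒≥ u≮base) u<) (sym (trans (cong (λ i → K + i * r)
          (∈-ι middle (∈-∖⁺ (∈-below⁺ u<) (u≮base ∘ ∈-below⁻ base)))) (cong (K +_) (*-identityˡ r))))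
  ... | no _ | no u≮ = trans (count-high u (≮⇒≥ u≮)) (sym (trans (cong (λ i → K + i * r)
          (∉-ι middle (λ u∈ → u≮ (∈-below⁻ (suc p * K)
            (proj₁ (∈-∖⁻ (below (suc p * K)) (below base) u∈)))))) (+-identityʳ K)))

  degree≡ : ∀ u → degree u ≡ k + ι (middle u) * r
  degree≡ u = suc-injective (trans (sym (count-closedNbr G u)) (count-nbr u))

  G-minDegree : HasMinDegree G k
  G-minDegree = (λ v → subst (k ≤_) (sym (degree≡ v)) (m≤m+n k _)) , zero ,
    trans (degree≡ zero) (trans (cong (k +_) (no-excess r refl)) (+-identityʳ k))
    where
    -- For `r = 0` the vertex `zero` may lie in `middle`, but then the excess vanishes; for `r > 0`
    -- it lies below `base`.
    no-excess : ∀ s → s ≡ r → ι (middle zero) * r ≡ 0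
    no-excess zero    refl = *-zeroʳ (ι (middle zero))
    no-excess (suc s) refl = cong (_* r) (∉-ι middle
      (λ 0∈ → proj₂ (∈-∖⁻ (below (suc p * K)) (below base) 0∈) (∈-below⁺ (m≤n⇒m≤o+n (p * K) (s≤s z≤n)))))

  size+size : ∀ {w} → r + w ≡ K → size + size ≡ order * k + r * w
  size+size {w} r+w≡K = begin
    size + size ≡⟨ handshake G ⟨
    sum degree ≡⟨ sum-cong-≗ degree≡ ⟩
    sum (λ u → k + ι (middle u) * r) ≡⟨ ∑-distrib-+ {order} (const k) (λ u → ι (middle u) * r) ⟩
    sum {order} (const k) + sum (λ u → ι (middle u) * r)
      ≡⟨ cong₂ _+_ (sum-const order k) (sym (*-distribʳ-sum r (ι ∘ middle))) ⟩
    order * k + count middle * r ≡⟨ cong (λ c → order * k + c * r) count-middle≡w ⟩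
    order * k + w * r ≡⟨ cong (order * k +_) (*-comm w r) ⟩
    order * k + r * w ∎
    where
    open ≡-Reasoning
    count-middle≡w : count middle ≡ w
    count-middle≡w = +-cancelˡ-≡ base _ _ (trans
      (count-interval base (suc p * K) base≤ (m≤m+n _ r)
        (λ u∈ → let u∈₁ , u∉ = ∈-∖⁻ (below (suc p * K)) (below base) u∈ in
          ≮⇒≥ (u∉ ∘ ∈-below⁺) , ∈-below⁻ (suc p * K) u∈₁)
        (λ lower upper → ∈-∖⁺ (∈-below⁺ upper) (λ u∈ → <⇒≱ (∈-below⁻ base u∈) lower)))
      (trans (cong (_+ p * K) (sym r+w≡K)) (shuffle r w (p * K))))
      where
      shuffle : ∀ a b c → a + b + c ≡ c + a + b
      shuffle = solve-∀

-- The closed form of the minimum size.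

nC2+nC2≡n*[n∸1] : ∀ n → n C 2 + n C 2 ≡ n * (n ∸ 1)
nC2+nC2≡n*[n∸1] zero    = refl
nC2+nC2≡n*[n∸1] (suc n) = begin
  suc n C 2 + suc n C 2                 ≡⟨ cong (λ c → c + c) (sym (nCk+nC[k+1]≡[n+1]C[k+1] n 1)) ⟩
  (n C 1 + n C 2) + (n C 1 + n C 2)     ≡⟨ shuffle (n C 1) (n C 2) ⟩
  n C 1 + n C 1 + (n C 2 + n C 2)       ≡⟨ cong₂ (λ a b → a + a + b) (nC1≡n n) (nC2+nC2≡n*[n∸1] n) ⟩
  n + n + n * (n ∸ 1)                   ≡⟨ step n ⟩
  suc n * n                             ∎
  where
  open ≡-Reasoning
  shuffle : ∀ a b → a + b + (a + b) ≡ a + a + (b + b)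
  shuffle = solve-∀
  step : ∀ n → n + n + n * (n ∸ 1) ≡ suc n * n
  step zero    = refl
  step (suc n) = identity n
    where
    identity : ∀ n → suc n + suc n + suc n * n ≡ suc (suc n) * suc n
    identity = solve-∀

n*[n∸1]/2≡nC2 : ∀ n → n * (n ∸ 1) / 2 ≡ n C 2
n*[n∸1]/2≡nC2 n = begin
  n * (n ∸ 1) / 2     ≡⟨ cong (_/ 2) (nC2+nC2≡n*[n∸1] n) ⟨
  (n C 2 + n C 2) / 2 ≡⟨ cong (_/ 2) (double (n C 2)) ⟩
  (n C 2) * 2 / 2     ≡⟨ m*n/n≡m (n C 2) 2 ⟩
  n C 2               ∎
  where
  open ≡-Reasoning
  double : ∀ a → a + a ≡ a * 2
  double = solve-∀

minimumSize : ℕ → ℕ → ℕ → ℕ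
minimumSize q k r = q * (suc k C 2) + k * r ∸ r * (r ∸ 1) / 2

-- Doubling clears the halves, and adding `h + h` clears the subtraction; what remains rests on
-- `w + (r - 1) = k` for positive `r`.
double-minimumSize : ∀ q k r {w} → r + w ≡ suc k → r ≤ k →
  minimumSize q k r + minimumSize q k r ≡ (q * suc k + r) * k + r * w
double-minimumSize q k r {w} r+w≡K r≤k = +-cancelʳ-≡ (h + h) _ _ (begin
  M + M + (h + h)                      ≡⟨ shuffle M h ⟩
  (M + h) + (M + h)                    ≡⟨ cong (λ a → a + a) M+h ⟩
  (q * c + k * r) + (q * c + k * r)    ≡⟨ collect q c (k * r) ⟩
  q * (c + c) + k * r + k * r
    ≡⟨ cong₂ (λ a b → q * a + k * r + b) (nC2+nC2≡n*[n∸1] (suc k)) (trans (*-comm k r) (sym r*w+r*[r∸1]≡r*k)) ⟩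
  q * (suc k * k) + k * r + (r * w + r * (r ∸ 1)) ≡⟨ cong (λ a → q * (suc k * k) + k * r + (r * w + a)) 2h ⟨
  q * (suc k * k) + k * r + (r * w + (h + h)) ≡⟨ distribute q k r (r * w) (h + h) ⟩
  (q * suc k + r) * k + r * w + (h + h) ∎)
  where
  open ≡-Reasoning
  M = minimumSize q k r
  c = suc k C 2
  h = r * (r ∸ 1) / 2
  2h : h + h ≡ r * (r ∸ 1)
  2h = trans (cong (λ a → a + a) (n*[n∸1]/2≡nC2 r)) (nC2+nC2≡n*[n∸1] r)
  -- The subtraction in `minimumSize` is not truncated, because `h` is at most `r * k`.
  h≤ : h ≤ q * c + k * r
  h≤ = ≤-trans (m+n≤o⇒n≤o h (≤-reflexive 2h)) (≤-trans
    (*-monoʳ-≤ r (≤-trans (m∸n≤m r 1) r≤k)) (≤-trans (≤-reflexive (*-comm r k)) (m≤n+m (k * r) (q * c))))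
  M+h : M + h ≡ q * c + k * r
  M+h = m∸n+n≡m h≤
  r*w+r*[r∸1]≡r*k : r * w + r * (r ∸ 1) ≡ r * k
  r*w+r*[r∸1]≡r*k = by-cases r r+w≡K
    where
    by-cases : ∀ r → r + w ≡ suc k → r * w + r * (r ∸ 1) ≡ r * k
    by-cases zero    _  = refl
    by-cases (suc r) eq = trans (sym (*-distribˡ-+ (suc r) w r))
      (cong (suc r *_) (trans (+-comm w r) (suc-injective eq)))
  shuffle : ∀ a b → a + a + (b + b) ≡ (a + b) + (a + b)
  shuffle = solve-∀
  collect : ∀ q c b → (q * c + b) + (q * c + b) ≡ q * (c + c) + b + b
  collect = solve-∀
  distribute : ∀ q k r a b → q * (suc k * k) + k * r + (a + b) ≡ (q * suc k + r) * k + a + b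
  distribute = solve-∀

-- Matching the lower bound with the extremal graph.

double-cancel-≤ : ∀ {a b} → a + a ≤ b + b → a ≤ b
double-cancel-≤ a+a≤b+b = ≮⇒≥ λ b<a → <⇒≱ (+-mono-< b<a b<a) a+a≤b+b

isMinimumSize : ∀ n k q r → suc k ≤ n → n ≡ q * suc k + r → r ≤ k →
  IsMinimumSize {n} (λ G → Chordal G × HasMinDegree G k) (minimumSize q k r)
-- A zero quotient would give `n = r ≤ k`, so there is always a complete block.
isMinimumSize _ k zero r k<n refl r≤k = contradiction r≤k (<⇒≱ k<n)
isMinimumSize _ k (suc p) r _ refl r≤k = lower , G , (G-chordal , G-minDegree) ,
  ≤-antisym (double-cancel-≤ (≤-reflexive 2size≡2M)) (double-cancel-≤ (≤-reflexive (sym 2size≡2M)))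
  where
  open Extremal p k r r≤k
  r+w≡K : r + (suc k ∸ r) ≡ suc k
  r+w≡K = m+[n∸m]≡n (m≤n⇒m≤1+n r≤k)
  2M≡ = double-minimumSize (suc p) k r r+w≡K r≤k
  2size≡2M = trans (size+size r+w≡K) (sym 2M≡)
  lower : ∀ H → Chordal H × HasMinDegree H k → minimumSize (suc p) k r ≤ Graph.size H
  lower H (chordal , k≤degree , _) = double-cancel-≤ (≤-trans (≤-reflexive 2M≡)
    (chordal-size H k chordal k≤degree (suc p) r+w≡K refl))

theorem4 : ∀ (n k q r : ℕ) → 1 ≤ n → 1 ≤ k → n ≥ k + 1 →
    n ≡ q * (k + 1) + r → r ≤ k →
    IsMinimumSize {n} (λ G → Chordal G × HasMinDegree G k)
    (q * ((k + 1) C 2) + k * r ∸ r * (r ∸ 1) / 2)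
theorem4 n k q r _ _ k<n n≡ r≤k rewrite +-comm k 1 = isMinimumSize n k q r k<n n≡ r≤k
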